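{- Let $q$ be an odd prime power, $r\in\{1,2\}$, $\xi$ a nonsquare in $\mathbb{F}_q$, and $a\in\mathbb{F}_{q^3}^*$ with $N_{q^3/q}(a)=-1$. Let $\mathcal{D}_A=(\mathbb{F}_{q^3}\times\mathbb{F}_{q^3},+,\star_A)$ be the presemifield with multiplication $$(u,v)\star_A(x,y)=(u,v)\begin{pmatrix} x & y\\ A_{a,r}(y) & \xi A_{a,r}(x)\end{pmatrix}=\big(ux+vA_{a,r}(y),\ uy+\xi vA_{a,r}(x)\big),$$ where $A_{a,r}(x)=x^{q^r}-a x^{q^{ -r}}$. Then, for fixed $q$, all such presemifields $\mathcal{D}_A$ (over all admissible $r,\xi,a$) are pairwise isotopic, and each of them is isotopic to the presemifield $(\mathbb{F}_{q^6},+,\star)$ with multiplication $$x\star y=(\alpha+\beta u+\gamma u^2)x+\gamma b\,x^{q^3},$$ for a suitable choice of $u\in\mathbb{F}_{q^3}\setminus\mathbb{F}_q$, $\sigma\in\mathbb{F}_q^*$ and $b\in\mathbb{F}_{q^6}$ with $u^3=\sigma u+1$ and $b^{q^3+1}=\sigma^2+9u+3\sigma u^2$; here, for $y\in\mathbb{F}_{q^6}$, the elements $\alpha,\beta,\gamma\in\mathbb{F}_{q^2}$ are the unique ones with $y=\alpha+\beta u+\gamma(b+u^2)$.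
   Context: $N_{q^3/q}(a)=a^{1+q+q^2}$ is the norm from $\mathbb{F}_{q^3}$ to $\mathbb{F}_q$. For $x\in\mathbb{F}_{q^3}$, $x^{q^{ -r}}$ denotes $x^{q^{3-r}}$. A presemifield is a finite algebra satisfying the axioms of a skewfield except associativity of multiplication and existence of an identity. Two presemifields $(\mathbb{S},+,\cdot)$, $(\mathbb{S}',+,\circ)$ of characteristic $p$ are isotopic if there are bijective $\mathbb{F}_p$-linear maps $g_1,g_2,g_3$ with $g_1(x\cdot y)=g_2(x)\circ g_3(y)$ for all $x,y$. -}

module Defs where

open import Level using (0ℓ)
open import Data.Nat using (ℕ; zero; suc; _≤_; _^_) renaming (_+_ to _ℕ+_)
open import Data.Nat.Primality using (Prime)
open import Data.Fin using (Fin)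
open import Data.Product using (Σ; ∃; _×_; _,_; proj₁)
open import Data.Unit using (⊤)
import Data.Sum
import Data.Nat
import Data.Product
open import Relation.Nullary using (¬_)
open import Relation.Binary.PropositionalEquality using (_≡_; _≢_)
open import Algebra.Bundles using (CommutativeRing)

OddPrimePower : ℕ → Set
OddPrimePower q = Σ ℕ λ p → Σ ℕ λ k → Prime p × p ≢ 2 × 1 ≤ k × q ≡ p ^ k

-- A "finite algebra" given as a subset (predicate In) of an ambient type
-- with a setoid equality, an addition and a multiplication; the algebra is
-- the subset In with the restricted operations.

record Alg : Set₁ where
  field
    A    : Set
    _≈_  : A → A → Set
    In   : A → Set
    _⊕_  : A → A → A
    _⊙_  : A → A → A

-- A bijective additive (= F_p-linear, F_p being the prime field) map between
-- the underlying sets of two such algebras.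
record LinBij (S T : Alg) : Set where
  private
    module S = Alg S
    module T = Alg T
  field
    fun   : S.A → T.A
    pres  : ∀ x → S.In x → T.In (fun x)
    cong  : ∀ x y → S.In x → S.In y → x S.≈ y → fun x T.≈ fun y
    add   : ∀ x y → S.In x → S.In y → fun (x S.⊕ y) T.≈ (fun x T.⊕ fun y)
    inj   : ∀ x y → S.In x → S.In y → fun x T.≈ fun y → x S.≈ y
    surj  : ∀ y → T.In y → Σ S.A λ x → S.In x × fun x T.≈ y

Isotopic : Alg → Alg → Set
Isotopic S T =
  Σ (LinBij S T) λ g₁ → Σ (LinBij S T) λ g₂ → Σ (LinBij S T) λ g₃ →
    ∀ x y → Alg.In S x → Alg.In S y →
      Alg._≈_ T (LinBij.fun g₁ (Alg._⊙_ S x y))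
                (Alg._⊙_ T (LinBij.fun g₂ x) (LinBij.fun g₃ y))

module FieldTheory (R : CommutativeRing 0ℓ 0ℓ) where
  open CommutativeRing R

  pow : Carrier → ℕ → Carrier
  pow x zero = 1#
  pow x (suc n) = x * pow x n

  fromℕ : ℕ → Carrier
  fromℕ zero = 0#
  fromℕ (suc n) = 1# + fromℕ n

  IsField : Set
  IsField = (1# ≉ 0#) × (∀ x → x ≉ 0# → Σ Carrier λ y → x * y ≈ 1#)

  HasOrder : ℕ → Set
  HasOrder N = Σ (Fin N → Carrier) λ f →
    (∀ i j → f i ≈ f j → i ≡ j) × (∀ x → Σ (Fin N) λ i → f i ≈ x)

  IsFiniteFieldOfOrder : ℕ → Set
  IsFiniteFieldOfOrder N = IsField × HasOrder N

  module InField (q : ℕ) where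
    -- in a field L of order q^6, the subfield F_{q^k} (k ∣ 6) is the set of
    -- fixed points of x ↦ x^{q^k}
    InF : ℕ → Carrier → Set
    InF k x = pow x (q ^ k) ≈ x

    norm : Carrier → Carrier
    norm a = pow a (1 ℕ+ q ℕ+ q ^ 2)

    NonsquareFq : Carrier → Set
    NonsquareFq ξ = InF 1 ξ × ¬ (Σ Carrier λ z → InF 1 z × z * z ≈ ξ)

    -- A_{a,r}(x) = x^{q^r} - a x^{q^{-r}}, with x^{q^{-r}} = x^{q^{3-r}}
    Amap : ℕ → Carrier → Carrier → Carrier
    Amap r a x = pow x (q ^ r) + (- (a * pow x (q ^ (3 Data.Nat.∸ r))))

    DA : ℕ → Carrier → Carrier → Alg
    DA r ξ a = record
      { A   = Carrier × Carrier
      ; _≈_ = λ { (u , v) (x , y) → (u ≈ x) × (v ≈ y) }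
      ; In  = λ { (u , v) → InF 3 u × InF 3 v }
      ; _⊕_ = λ { (u , v) (x , y) → (u + x , v + y) }
      ; _⊙_ = λ { (u , v) (x , y) →
                  ( u * x + v * Amap r a y
                  , u * y + ξ * (v * Amap r a x) ) }
      }

    Admissible : ℕ → Carrier → Carrier → Set
    Admissible r ξ a =
      (r ≡ 1 Data.Sum.⊎ r ≡ 2) × NonsquareFq ξ ×
      InF 3 a × (a ≉ 0#) × norm a ≈ (- 1#)

    GoodUσb : Carrier → Carrier → Carrier → Set
    GoodUσb u σ b =
      InF 3 u × ¬ InF 1 u ×
      InF 1 σ × σ ≉ 0# ×
      pow u 3 ≈ σ * u + 1# ×
      pow b (q ^ 3 ℕ+ 1) ≈ σ * σ + fromℕ 9 * u + fromℕ 3 * σ * (u * u)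

    Coords : Carrier → Carrier → Carrier → Set
    Coords u b y = Σ Carrier λ α → Σ Carrier λ β → Σ Carrier λ γ →
      InF 2 α × InF 2 β × InF 2 γ × y ≈ α + β * u + γ * (b + u * u)

    CoordsUnique : Carrier → Carrier → Carrier → Set
    CoordsUnique u b y = ∀ α β γ α' β' γ' →
      InF 2 α → InF 2 β → InF 2 γ → InF 2 α' → InF 2 β' → InF 2 γ' →
      y ≈ α + β * u + γ * (b + u * u) →
      y ≈ α' + β' * u + γ' * (b + u * u) →
      (α ≈ α') × (β ≈ β') × (γ ≈ γ')

    Star : (u b : Carrier) → ((y : Carrier) → Coords u b y) → Alg
    Star u b co = record
      { A   = Carrier
      ; _≈_ = _≈_
      ; In  = λ _ → ⊤
      ; _⊕_ = _+_
      ; _⊙_ = λ x y →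
          let α = proj₁ (co y)
              β = proj₁ (Data.Product.proj₂ (co y))
              γ = proj₁ (Data.Product.proj₂ (Data.Product.proj₂ (co y)))
          in (α + β * u + γ * (u * u)) * x + γ * b * pow x (q ^ 3)
      }

{-# OPTIONS --safe #-}

-- Write x̄ = x^{q³}, and let T be the trace of L over F_{q²}, which on F_{q³} is the trace to F_q.
-- Scaling x and y by an element supplied by Hilbert 90 turns A_{a,r} into A_{-1,r}(x) = T(x) - x. Let
-- η² = ξ, so that η̄ = -η, and put Z = x + y/η, W = s - tη; reading a pair (m, n) as m + n/η, the
-- product (s, t) ⋆ (x, y) becomes WZ + (W̄ - W)T(Z)/2. Let u³ = σu + 1 generate F_{q³} over F_q and
-- put d = 3u² - σ. If Z = Y/d with Y = C₀ + C₁u + C₂u² and Cᵢ in F_{q²}, then T(Z) = C₂, and d times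
-- the product is the product of the target presemifield, with γ = -C₂/2 and b = -d. So all the 𝒟_A
-- are isotopic to one and the same presemifield.
--
-- A root of X² - ξ or X³ - σX - 1 in L exists because otherwise L[X]/(f) is a domain in which the
-- class of X is fixed by the q⁶-th power map, as are the q⁶ elements of L.
module Submission where

open import Defs
open import Level using (0ℓ)
open import Algebra.Bundles using (AbelianGroup; CommutativeRing; RawRing)
import Algebra.Construct.DirectProduct as DirectProduct
open import Data.Empty using (⊥)
open import Data.Fin as Fin using (Fin; zero; suc)
open import Data.Fin.Patterns using (0F; 1F; 2F; 3F; 4F)
open import Data.Fin.Permutation using (Permutation; permutation; _⟨$⟩ʳ_)
import Data.Fin.Properties as Fin
open import Data.Integer as ℤ using (ℤ; +_; -[1+_]; _⊖_)
import Data.Integer.Properties as ℤ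
open import Data.Maybe using (Maybe; just; nothing)
open import Data.Nat as ℕ using (ℕ; zero; suc)
open import Data.Nat.Combinatorics using (_C_; nCn≡1; nCk+nC[k+1]≡[n+1]C[k+1])
open import Data.Nat.Divisibility using (_∣_; divides; ∣⇒≤)
open import Data.Nat.Primality using (Prime; euclidsLemma; prime⇒irreducible; prime⇒nonTrivial)
import Data.Nat.Properties as ℕ
open import Data.Product using (Σ; _×_; _,_; proj₁; proj₂)
open import Data.Sum as Sum using (_⊎_; inj₁; inj₂; [_,_]′)
open import Data.Unit using (⊤; tt)
open import Data.Vec using ([]; _∷_)
open import Data.Vec.Relation.Binary.Pointwise.Inductive as Pointwise using (Pointwise; []; _∷_)
open import Function using (Injective)
open import Relation.Binary.PropositionalEquality as ≡ using (_≡_; _≢_)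
open import Relation.Binary.Structures using (IsEquivalence)
open import Relation.Nullary using (¬_; Dec; yes; no; contradiction)
open import Relation.Nullary.Decidable using (map′; decidable-stable; _×-dec_; ¬?)

-- All that is known of `L` is that it is a field with `q⁶` elements up to a setoid equality. Its
-- subfields are therefore the fixed sets of iterates of the `q`-th power map `F`, and every
-- Galois-theoretic step is an identity between iterates of `F`, certified by the ring solver. A
-- norm of -1 suits Hilbert 90 because three signs multiply to -1, so that `-a` has norm 1. On
-- F_{q³} the map `T(x) - x` equals `F x + F² x`, which is symmetric under exchanging `r` with
-- `3 - r`; this is why `r` disappears. The cubic has no quadratic term, so three distinct roots sum
-- to zero, and has constant term -1, so a root is nonzero and determines `σ`; a pigeonhole argument
-- then yields some `σ` without a root in F_q. The choice `b = -d` solves the norm condition inside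
-- F_{q³}: there `b^(q³+1)` is `b²`, and `(3u² - σ)²` reduces modulo the cubic to `σ² + 9u + 3σu²`.
-- Moreover `b + u² = σ - 2u²`, so unique coordinates come down to the independence of `1`, `u`,
-- `u²` over F_{q²} and to the invertibility of 2. Neither `u`, `σ` nor `b` depends on `r`, `ξ`,
-- `a`.

-- A ring solver with integer coefficients.

module IntegerSolver (R : CommutativeRing 0ℓ 0ℓ) where
  open CommutativeRing R hiding (zero)
  open import Algebra.Solver.Ring.AlmostCommutativeRing
  open import Algebra.Properties.Semiring.Mult.TCOptimised semiring
    using (1+×; ×-homo-+; ×1-homo-*) renaming (_×_ to _·_)
  open import Algebra.Properties.Ring ring
  open import Relation.Binary.Reasoning.Setoid setoid

  -- The natural multiples are the variant in which `1 · 1#` reduces to `1#`, so the solver constant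
  -- `one` denotes `1#` definitionally.
  ⟦_⟧ℤ : ℤ → Carrier
  ⟦ + n ⟧ℤ = n · 1#
  ⟦ -[1+ n ] ⟧ℤ = - (suc n · 1#)

  private
    neg-homo : ∀ i → ⟦ ℤ.- i ⟧ℤ ≈ - ⟦ i ⟧ℤ
    neg-homo (+ zero) = sym -0#≈0#
    neg-homo (+ suc n) = refl
    neg-homo -[1+ n ] = sym (-‿involutive _)

    cancel : ∀ a x y → (a + x) + - (a + y) ≈ x + - y
    cancel a x y = begin
      (a + x) + - (a + y)    ≈⟨ +-cong (+-comm a x) (sym (-‿+-comm a y)) ⟩
      (x + a) + (- a + - y)  ≈⟨ +-assoc x a _ ⟩
      x + (a + (- a + - y))  ≈⟨ +-congˡ (+-assoc a (- a) (- y)) ⟨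
      x + ((a + - a) + - y)  ≈⟨ +-congˡ (+-congʳ (-‿inverseʳ a)) ⟩
      x + (0# + - y)         ≈⟨ +-congˡ (+-identityˡ _) ⟩
      x + - y ∎

    ⊖-homo : ∀ m n → ⟦ m ⊖ n ⟧ℤ ≈ m · 1# + - (n · 1#)
    ⊖-homo zero zero = sym (-‿inverseʳ 0#)
    ⊖-homo zero (suc n) = sym (+-identityˡ _)
    ⊖-homo (suc m) zero = sym (trans (+-congˡ -0#≈0#) (+-identityʳ _))
    ⊖-homo (suc m) (suc n) = begin
      ⟦ suc m ⊖ suc n ⟧ℤ  ≡⟨ ≡.cong ⟦_⟧ℤ (ℤ.[1+m]⊖[1+n]≡m⊖n m n) ⟩
      ⟦ m ⊖ n ⟧ℤ          ≈⟨ ⊖-homo m n ⟩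
      m · 1# + - (n · 1#) ≈⟨ cancel 1# _ _ ⟨
      (1# + m · 1#) + - (1# + n · 1#) ≈⟨ +-cong (1+× m 1#) (-‿cong (1+× n 1#)) ⟨
      suc m · 1# + - (suc n · 1#) ∎

    +-homo : ∀ i j → ⟦ i ℤ.+ j ⟧ℤ ≈ ⟦ i ⟧ℤ + ⟦ j ⟧ℤ
    +-homo (+ m) (+ n) = ×-homo-+ 1# m n
    +-homo (+ m) -[1+ n ] = ⊖-homo m (suc n)
    +-homo -[1+ m ] (+ n) = trans (⊖-homo n (suc m)) (+-comm _ _)
    +-homo -[1+ m ] -[1+ n ] = trans
      (-‿cong (trans (reflexive (≡.cong (λ k → suc k · 1#) (≡.sym (ℕ.+-suc m n)))) (×-homo-+ 1# (suc m) (suc n))))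
      (sym (-‿+-comm _ _))

    *-homo : ∀ i j → ⟦ i ℤ.* j ⟧ℤ ≈ ⟦ i ⟧ℤ * ⟦ j ⟧ℤ
    *-homo (+ m) (+ n) = trans (reflexive (≡.cong ⟦_⟧ℤ (≡.sym (ℤ.pos-* m n)))) (×1-homo-* m n)
    *-homo (+ m) -[1+ n ] = begin
      ⟦ + m ℤ.* -[1+ n ] ⟧ℤ ≡⟨ ≡.cong ⟦_⟧ℤ (ℤ.neg-distribʳ-* (+ m) (+ suc n)) ⟨
      ⟦ ℤ.- (+ m ℤ.* + suc n) ⟧ℤ ≈⟨ neg-homo (+ m ℤ.* + suc n) ⟩
      - ⟦ + m ℤ.* + suc n ⟧ℤ ≈⟨ -‿cong (*-homo (+ m) (+ suc n)) ⟩
      - (m · 1# * (suc n · 1#)) ≈⟨ -‿distribʳ-* _ _ ⟩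
      m · 1# * - (suc n · 1#) ∎
    *-homo -[1+ m ] (+ n) = begin
      ⟦ -[1+ m ] ℤ.* + n ⟧ℤ ≡⟨ ≡.cong ⟦_⟧ℤ (ℤ.neg-distribˡ-* (+ suc m) (+ n)) ⟨
      ⟦ ℤ.- (+ suc m ℤ.* + n) ⟧ℤ ≈⟨ neg-homo (+ suc m ℤ.* + n) ⟩
      - ⟦ + suc m ℤ.* + n ⟧ℤ ≈⟨ -‿cong (*-homo (+ suc m) (+ n)) ⟩
      - (suc m · 1# * (n · 1#)) ≈⟨ -‿distribˡ-* _ _ ⟩
      - (suc m · 1#) * (n · 1#) ∎
    *-homo -[1+ m ] -[1+ n ] = begin
      ⟦ + suc m ℤ.* + suc n ⟧ℤ ≈⟨ *-homo (+ suc m) (+ suc n) ⟩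
      x * y ≈⟨ -‿involutive _ ⟨
      - - (x * y) ≈⟨ -‿cong (-‿distribˡ-* x y) ⟩
      - (- x * y) ≈⟨ -‿distribʳ-* _ _ ⟩
      - x * - y ∎
      where
        x = suc m · 1#
        y = suc n · 1#

    ℤ-rawRing : RawRing 0ℓ 0ℓ
    ℤ-rawRing = record
      { Carrier = ℤ ; _≈_ = ≡._≡_ ; _+_ = ℤ._+_ ; _*_ = ℤ._*_
      ; -_ = ℤ.-_ ; 0# = + 0 ; 1# = + 1 }

    morphism : ℤ-rawRing -Raw-AlmostCommutative⟶ fromCommutativeRing R
    morphism = record
      { ⟦_⟧ = ⟦_⟧ℤ ; +-homo = +-homo ; *-homo = *-homo ; -‿homo = neg-homo
      ; 0-homo = refl ; 1-homo = refl }

    coeff≟ : ∀ i j → Maybe (⟦ i ⟧ℤ ≈ ⟦ j ⟧ℤ)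
    coeff≟ i j with i ℤ.≟ j
    ... | yes i≡j = just (reflexive (≡.cong ⟦_⟧ℤ i≡j))
    ... | no _ = nothing

  open import Algebra.Solver.Ring ℤ-rawRing (fromCommutativeRing R) morphism coeff≟ public
    using (Polynomial; op; [+]; [*]; con; var; _:^_; :-_; ⟦_⟧; solve; _:+_; _:*_; _:-_; _:=_)

  one zer : ∀ {n} → Polynomial n
  one = con (+ 1)
  zer = con (+ 0)

-- Binomial coefficients divisible by a prime.

-- The absorption identity, free of division. Pascal's rule splits the left side, and the two
-- induction hypotheses recombine by Pascal's rule one row earlier.
[1+k]*[1+n]C[1+k] : ∀ n k → suc k ℕ.* (suc n C suc k) ≡ suc n ℕ.* (n C k)
[1+k]*[1+n]C[1+k] zero zero = ≡.refl
[1+k]*[1+n]C[1+k] zero (suc k) = ℕ.*-zeroʳ (suc (suc k))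
[1+k]*[1+n]C[1+k] (suc n) zero = ≡.trans (ℕ.*-identityˡ _)
  (≡.trans (≡.sym (nCk+nC[k+1]≡[n+1]C[k+1] (suc n) 0))
           (≡.cong suc (≡.trans (≡.sym (ℕ.*-identityˡ _)) ([1+k]*[1+n]C[1+k] n 0))))
[1+k]*[1+n]C[1+k] (suc n) (suc k) = begin
  suc (suc k) ℕ.* (suc (suc n) C suc (suc k))
    ≡⟨ ≡.cong (suc (suc k) ℕ.*_) (nCk+nC[k+1]≡[n+1]C[k+1] (suc n) (suc k)) ⟨
  suc (suc k) ℕ.* (c ℕ.+ (suc n C suc (suc k)))
    ≡⟨ ℕ.*-distribˡ-+ (suc (suc k)) c _ ⟩
  (c ℕ.+ suc k ℕ.* c) ℕ.+ suc (suc k) ℕ.* (suc n C suc (suc k))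
    ≡⟨ ≡.cong₂ (λ a b → (c ℕ.+ a) ℕ.+ b) ([1+k]*[1+n]C[1+k] n k) ([1+k]*[1+n]C[1+k] n (suc k)) ⟩
  (c ℕ.+ suc n ℕ.* (n C k)) ℕ.+ suc n ℕ.* (n C suc k)
    ≡⟨ ℕ.+-assoc c _ _ ⟩
  c ℕ.+ (suc n ℕ.* (n C k) ℕ.+ suc n ℕ.* (n C suc k))
    ≡⟨ ≡.cong (λ z → c ℕ.+ z) (ℕ.*-distribˡ-+ (suc n) (n C k) (n C suc k)) ⟨
  c ℕ.+ suc n ℕ.* ((n C k) ℕ.+ (n C suc k))
    ≡⟨ ≡.cong (λ z → c ℕ.+ suc n ℕ.* z) (nCk+nC[k+1]≡[n+1]C[k+1] n k) ⟩
  suc (suc n) ℕ.* c ∎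
  where
    open ≡.≡-Reasoning
    c = suc n C suc k

-- By absorption the prime divides `suc k` times the coefficient, and it is too large to divide
-- `suc k`.
prime∣nCk : ∀ {n k} → Prime (suc n) → k ℕ.< n → suc n ∣ suc n C suc k
prime∣nCk {n} {k} pr k<n with euclidsLemma (suc k) (suc n C suc k) pr
  (divides (n C k) (≡.trans ([1+k]*[1+n]C[1+k] n k) (ℕ.*-comm (suc n) (n C k))))
... | inj₁ p∣k = contradiction (∣⇒≤ p∣k) (ℕ.<⇒≱ (ℕ.s<s k<n))
... | inj₂ p∣C = p∣C

-- Powers, and their additivity in characteristic p.

module Powers (R : CommutativeRing 0ℓ 0ℓ) where
  open CommutativeRing R hiding (zero)
  open FieldTheory R
  open IntegerSolver R
  open import Algebra.Properties.Semiring.Exp semiring using (_^_; ^-congˡ; ^-homo-*; ^-assocʳ)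
  open import Algebra.Properties.CommutativeSemiring.Exp commutativeSemiring using (^-distrib-*)
  open import Algebra.Properties.Semiring.Mult semiring
    using (×-congʳ; ×-homo-1; ×-assoc-*; ×1-homo-*) renaming (_×_ to _·_)
  open import Algebra.Properties.CommutativeSemiring.Binomial commutativeSemiring
    using (theorem; binomialTerm)
  open import Algebra.Properties.Semiring.Sum semiring
    using (sum; sum-init-last; sum-cong-≋; sum-replicate-zero)
  open import Relation.Binary.Reasoning.Setoid setoid

  pow≡^ : ∀ x n → pow x n ≡ x ^ n
  pow≡^ x zero = ≡.refl
  pow≡^ x (suc n) = ≡.cong (x *_) (pow≡^ x n)

  fromℕ≡· : ∀ n → fromℕ n ≡ n · 1#
  fromℕ≡· zero = ≡.refl
  fromℕ≡· (suc n) = ≡.cong (λ z → 1# + z) (fromℕ≡· n)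

  pow-cong : ∀ n {x y} → x ≈ y → pow x n ≈ pow y n
  pow-cong n {x} {y} eq rewrite pow≡^ x n | pow≡^ y n = ^-congˡ n eq

  pow-+ : ∀ x m n → pow x (m ℕ.+ n) ≈ pow x m * pow x n
  pow-+ x m n rewrite pow≡^ x (m ℕ.+ n) | pow≡^ x m | pow≡^ x n = ^-homo-* x m n

  pow-pow : ∀ x m n → pow (pow x m) n ≈ pow x (m ℕ.* n)
  pow-pow x m n rewrite pow≡^ x m | pow≡^ (x ^ m) n | pow≡^ x (m ℕ.* n) = ^-assocʳ x m n

  pow-* : ∀ x y n → pow (x * y) n ≈ pow x n * pow y n
  pow-* x y n rewrite pow≡^ (x * y) n | pow≡^ x n | pow≡^ y n = ^-distrib-* x y n

  pow-1# : ∀ n → pow 1# n ≈ 1#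
  pow-1# zero = refl
  pow-1# (suc n) = trans (*-identityˡ _) (pow-1# n)

  fromℕ-* : ∀ m n → fromℕ (m ℕ.* n) ≈ fromℕ m * fromℕ n
  fromℕ-* m n rewrite fromℕ≡· (m ℕ.* n) | fromℕ≡· m | fromℕ≡· n = ×1-homo-* m n

  x-y≈0⇒x≈y : ∀ {x y} → x + - y ≈ 0# → x ≈ y
  x-y≈0⇒x≈y {x} {y} eq = trans
    (solve 2 (λ x y → x := (x :- y) :+ y) refl x y) (trans (+-congʳ eq) (+-identityˡ y))

  x≈y⇒x-y≈0 : ∀ {x y} → x ≈ y → x + - y ≈ 0#
  x≈y⇒x-y≈0 {x} {y} eq = trans (+-congʳ eq) (-‿inverseʳ y)

  x+y≈0⇒x≈-y : ∀ {x y} → x + y ≈ 0# → x ≈ - y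
  x+y≈0⇒x≈-y {x} {y} eq = trans
    (solve 2 (λ x y → x := (x :+ y) :- y) refl x y) (trans (+-congʳ eq) (+-identityˡ (- y)))

  -- Turns a relation `l ≈ r` into a rewriting rule for the solver: an equality valid only modulo
  -- `l - r` becomes a polynomial identity once the cofactor `c` is written down. The cofactors in
  -- later proofs are such certificates.
  modulo : ∀ {l r x y c} → l ≈ r → x ≈ y + c * (l + - r) → x ≈ y
  modulo {c = c} l≈r eq = trans eq
    (trans (+-congˡ (trans (*-congˡ (x≈y⇒x-y≈0 l≈r)) (zeroʳ c))) (+-identityʳ _))

  modulo₂ : ∀ {l r l′ r′ x y c c′} → l ≈ r → l′ ≈ r′ →
    x ≈ y + c * (l + - r) + c′ * (l′ + - r′) → x ≈ y
  modulo₂ e e′ eq = modulo e (modulo e′ eq)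

  modulo₃ : ∀ {l r l′ r′ l″ r″ x y c c′ c″} → l ≈ r → l′ ≈ r′ → l″ ≈ r″ →
    x ≈ y + c * (l + - r) + c′ * (l′ + - r′) + c″ * (l″ + - r″) → x ≈ y
  modulo₃ e e′ e″ eq = modulo e (modulo e′ (modulo e″ eq))

  module CharacteristicP {p : ℕ} (pr : Prime p) (p≈0 : fromℕ p ≈ 0#) where

    multiple-vanishes : ∀ {n} x → p ∣ n → n · x ≈ 0#
    multiple-vanishes {n} x (divides d n≡dp) = begin
      n · x              ≡⟨ ≡.cong (_· x) n≡dp ⟩
      (d ℕ.* p) · x      ≈⟨ ×-congʳ (d ℕ.* p) (*-identityˡ x) ⟨
      (d ℕ.* p) · (1# * x) ≈⟨ ×-assoc-* (d ℕ.* p) 1# x ⟨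
      (d ℕ.* p) · 1# * x ≈⟨ *-congʳ (×1-homo-* d p) ⟩
      d · 1# * (p · 1#) * x ≡⟨ ≡.cong (λ z → d · 1# * z * x) (fromℕ≡· p) ⟨
      d · 1# * fromℕ p * x ≈⟨ *-congʳ (*-congˡ p≈0) ⟩
      d · 1# * 0# * x    ≈⟨ *-congʳ (zeroʳ _) ⟩
      0# * x             ≈⟨ zeroˡ x ⟩
      0#                 ∎

    freshman : ∀ x y → pow (x + y) p ≈ pow x p + pow y p
    freshman x y = helper p pr multiple-vanishes
      where
      -- `p` is abstracted so that it can be matched as `suc n`; the characteristic enters only
      -- through the last premise.
      helper : ∀ p → Prime p → (∀ {n} x → p ∣ n → n · x ≈ 0#) → pow (x + y) p ≈ pow x p + pow y p
      helper zero pr _ with () ← prime⇒nonTrivial pr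
      helper (suc n) pr vanish = begin
        pow (x + y) (suc n)   ≡⟨ pow≡^ (x + y) (suc n) ⟩
        (x + y) ^ suc n       ≈⟨ theorem (suc n) x y ⟩
        t zero + sum (λ i → t (suc i)) ≈⟨ +-congˡ (sum-init-last (λ i → t (suc i))) ⟩
        t zero + (sum (λ i → t (suc (Fin.inject₁ i))) + t (suc (Fin.fromℕ n)))
          ≈⟨ +-cong first (+-cong middle last) ⟩
        y ^ suc n + (0# + x ^ suc n)
          ≈⟨ solve 2 (λ a b → b :+ (zer :+ a) := a :+ b) refl (x ^ suc n) (y ^ suc n) ⟩
        x ^ suc n + y ^ suc n ≡⟨ ≡.cong₂ _+_ (pow≡^ x (suc n)) (pow≡^ y (suc n)) ⟨
        pow x (suc n) + pow y (suc n) ∎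
        where
        t = binomialTerm x y (suc n)

        first : t zero ≈ y ^ suc n
        first = trans (+-identityʳ _) (*-identityˡ _)

        middle : sum (λ i → t (suc (Fin.inject₁ i))) ≈ 0#
        middle = trans
          (sum-cong-≋ {n} (λ i → vanish _ (prime∣nCk pr
            (≡.subst (ℕ._< n) (≡.sym (Fin.toℕ-inject₁ i)) (Fin.toℕ<n i)))))
          (sum-replicate-zero n)

        last : t (suc (Fin.fromℕ n)) ≈ x ^ suc n
        last rewrite Fin.toℕ-fromℕ n | nCn≡1 (suc n) | ℕ.n∸n≡0 n =
          trans (×-homo-1 _) (*-identityʳ _)

    frobenius-+ : ∀ k x y → pow (x + y) (p ℕ.^ k) ≈ pow x (p ℕ.^ k) + pow y (p ℕ.^ k)
    frobenius-+ zero x y = solve 2 (λ x y → (x :+ y) :* one := x :* one :+ y :* one) refl x y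
    frobenius-+ (suc k) x y = begin
      pow (x + y) (p ℕ.* p ℕ.^ k) ≈⟨ pow-pow (x + y) p (p ℕ.^ k) ⟨
      pow (pow (x + y) p) (p ℕ.^ k) ≈⟨ pow-cong (p ℕ.^ k) (freshman x y) ⟩
      pow (pow x p + pow y p) (p ℕ.^ k) ≈⟨ frobenius-+ k _ _ ⟩
      pow (pow x p) (p ℕ.^ k) + pow (pow y p) (p ℕ.^ k)
        ≈⟨ +-cong (pow-pow x p (p ℕ.^ k)) (pow-pow y p (p ℕ.^ k)) ⟩
      pow x (p ℕ.* p ℕ.^ k) + pow y (p ℕ.* p ℕ.^ k) ∎

-- Counting roots in an integral domain.

module IntegralDomain (R : CommutativeRing 0ℓ 0ℓ) where
  open CommutativeRing R hiding (zero)

  module Domain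
    (1≉0 : 1# ≉ 0#)
    (integral : ∀ {x y} → x * y ≈ 0# → x ≈ 0# ⊎ y ≈ 0#) where
    open FieldTheory R
    open IntegerSolver R
    open Powers R

    cancelˡ : ∀ {a x y} → a ≉ 0# → a * x ≈ a * y → x ≈ y
    cancelˡ {a} {x} {y} a≉0 eq with integral
      (trans (solve 3 (λ a x y → a :* (x :- y) := a :* x :- a :* y) refl a x y) (x≈y⇒x-y≈0 eq))
    ... | inj₁ a≈0 = contradiction a≈0 a≉0
    ... | inj₂ d≈0 = x-y≈0⇒x≈y d≈0

    *-nonzero : ∀ {x y} → x ≉ 0# → y ≉ 0# → x * y ≉ 0#
    *-nonzero x≉0 y≉0 xy≈0 = [ x≉0 , y≉0 ]′ (integral xy≈0)

    pow≈0 : ∀ n {x} → pow x n ≈ 0# → x ≈ 0#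
    pow≈0 zero eq = contradiction eq 1≉0
    pow≈0 (suc n) eq with integral eq
    ... | inj₁ x≈0 = x≈0
    ... | inj₂ eq′ = pow≈0 n eq′

    -- Horner form of a monic polynomial, attached to the function it induces. Working with
    -- functions up to pointwise equality avoids any comparison of coefficients.
    data MonicOfDegree : ℕ → (Carrier → Carrier) → Set where
      unit  : ∀ {g} → (∀ y → g y ≈ 1#) → MonicOfDegree 0 g
      shift : ∀ {n g h} c → MonicOfDegree n h → (∀ y → g y ≈ y * h y + c) → MonicOfDegree (suc n) g

    -- Synthetic division: the quotient for `y * h y + c` is `y` times the quotient for `h`, plus
    -- the remainder `h a`.
    factor : ∀ {n g} → MonicOfDegree (suc n) g → ∀ a →
      Σ (Carrier → Carrier) λ h → MonicOfDegree n h × ∀ y → g y ≈ (y + - a) * h y + g a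
    factor (shift {g = g} {h} c (unit h≈1) g≈) a =
      (λ _ → 1#) , unit (λ _ → refl) , λ y →
        trans (trans (g≈ y) (+-congʳ (*-congˡ (h≈1 y))))
          (trans (solve 3 (λ y a c → y :* one :+ c := (y :- a) :* one :+ (a :* one :+ c)) refl y a c)
            (+-congˡ (sym (trans (g≈ a) (+-congʳ (*-congˡ (h≈1 a)))))))
    factor (shift {g = g} {h} c m@(shift _ _ _) g≈) a with factor m a
    ... | k , k-monic , h≈ =
      (λ y → y * k y + h a) , shift (h a) k-monic (λ _ → refl) , λ y →
        trans (trans (g≈ y) (+-congʳ (*-congˡ (h≈ y))))
          (trans (solve 5 (λ y a c k e → y :* ((y :- a) :* k :+ e) :+ c := (y :- a) :* (y :* k :+ e) :+ (a :* e :+ c))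
                   refl y a c (k y) (h a))
            (+-congˡ (sym (g≈ a))))

    tooManyRoots : ∀ {n g} → MonicOfDegree n g → (r : Fin (suc n) → Carrier) →
      (∀ i j → r i ≈ r j → i ≡ j) → (∀ i → g (r i) ≈ 0#) → ⊥
    tooManyRoots (unit g≈1) r r-inj root = 1≉0 (trans (sym (g≈1 (r zero))) (root zero))
    tooManyRoots {suc n} {g} m@(shift _ _ _) r r-inj root with factor m (r zero)
    ... | h , h-monic , g≈ = tooManyRoots h-monic (λ i → r (suc i))
            (λ i j eq → Fin.suc-injective (r-inj _ _ eq)) root′
      where
      root′ : ∀ i → h (r (suc i)) ≈ 0#
      root′ i with integral (trans (trans (sym (+-identityʳ _))
                    (trans (+-congˡ (sym (root zero))) (sym (g≈ (r (suc i)))))) (root (suc i)))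
      ... | inj₁ eq with () ← r-inj (suc i) zero (x-y≈0⇒x≈y eq)
      ... | inj₂ eq = eq

    pow-monic : ∀ n → MonicOfDegree n (λ y → pow y n)
    pow-monic zero = unit (λ _ → refl)
    pow-monic (suc n) = shift 0# (pow-monic n) (λ _ → sym (+-identityʳ _))

    pow-fixed-bound : ∀ {n} → 2 ℕ.≤ n → (r : Fin (suc n) → Carrier) →
      (∀ i j → r i ≈ r j → i ≡ j) → (∀ i → pow (r i) n ≈ r i) → ⊥
    pow-fixed-bound {suc (suc n)} _ r r-inj fixed = tooManyRoots
      -- Horner form of the fixed-point polynomial, `y (y y^n - 1) + 0` with `n` two below the
      -- exponent. For exponent 1 it would vanish identically, hence the bound.
      (shift 0# (shift (- 1#) (pow-monic n) (λ _ → refl)) (λ _ → refl)) r r-inj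
      (λ i → trans (solve 2 (λ x z → x :* (x :* z :- one) :+ zer := x :* (x :* z) :- x) refl (r i) (pow (r i) n))
        (x≈y⇒x-y≈0 (fixed i)))
    pow-fixed-bound {suc zero} (ℕ.s≤s ())

-- Finite fields: decidability, characteristic, Fermat's theorem.

module FiniteField (L : CommutativeRing 0ℓ 0ℓ) (N : ℕ)
  (isFiniteField : FieldTheory.IsFiniteFieldOfOrder L N) where
  open CommutativeRing L hiding (zero)
  open FieldTheory L
  open IntegerSolver L
  open Powers L
  open import Algebra.Properties.Monoid.Sum +-monoid using (sum; sum-cong-≋; sum-replicate)
  open import Algebra.Properties.CommutativeMonoid.Sum +-commutativeMonoid
    using (sum-permute; ∑-distrib-+)
  open import Algebra.Properties.CommutativeMonoid.Sum *-commutativeMonoid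
    using ()
    renaming ( sum to prod; sum-permute to prod-permute; ∑-distrib-+ to prod-distrib
             ; sum-cong-≋ to prod-cong; sum-replicate to prod-replicate)
  open import Relation.Binary.Reasoning.Setoid setoid

  1≉0 : 1# ≉ 0#
  1≉0 = proj₁ (proj₁ isFiniteField)

  inverse : ∀ x → x ≉ 0# → Σ Carrier λ y → x * y ≈ 1#
  inverse = proj₂ (proj₁ isFiniteField)

  element : Fin N → Carrier
  element = proj₁ (proj₂ isFiniteField)

  element-injective : ∀ i j → element i ≈ element j → i ≡ j
  element-injective = proj₁ (proj₂ (proj₂ isFiniteField))

  index : Carrier → Fin N
  index x = proj₁ (proj₂ (proj₂ (proj₂ isFiniteField)) x)

  element-index : ∀ x → element (index x) ≈ x
  element-index x = proj₂ (proj₂ (proj₂ (proj₂ isFiniteField)) x)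

  index-cong : ∀ {x y} → x ≈ y → index x ≡ index y
  index-cong {x} {y} eq = element-injective _ _
    (trans (element-index x) (trans eq (sym (element-index y))))

  index-injective : ∀ {x y} → index x ≡ index y → x ≈ y
  index-injective {x} {y} eq = trans (sym (element-index x))
    (trans (reflexive (≡.cong element eq)) (element-index y))

  index-element : ∀ i → index (element i) ≡ i
  index-element i = element-injective _ _ (element-index (element i))

  infix 4 _≟_
  _≟_ : ∀ x y → Dec (x ≈ y)
  x ≟ y = map′ index-injective index-cong (index x Fin.≟ index y)

  search : {P : Carrier → Set} → (∀ {x y} → x ≈ y → P x → P y) → (∀ x → Dec (P x)) → Dec (Σ Carrier P)
  search resp P? = map′ (λ (i , p) → element i , p)
    (λ (x , p) → index x , resp (sym (element-index x)) p) (Fin.any? (λ i → P? (element i)))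

  integral : ∀ {x y} → x * y ≈ 0# → x ≈ 0# ⊎ y ≈ 0#
  integral {x} {y} xy≈0 with x ≟ 0#
  ... | yes x≈0 = inj₁ x≈0
  ... | no x≉0 with inverse x x≉0
  ...   | x⁻¹ , xx⁻¹≈1 = inj₂ (begin
    y               ≈⟨ *-identityˡ y ⟨
    1# * y          ≈⟨ *-congʳ xx⁻¹≈1 ⟨
    x * x⁻¹ * y     ≈⟨ solve 3 (λ x y z → x :* z :* y := z :* (x :* y)) refl x y x⁻¹ ⟩
    x⁻¹ * (x * y)   ≈⟨ *-congˡ xy≈0 ⟩
    x⁻¹ * 0#        ≈⟨ zeroʳ x⁻¹ ⟩
    0# ∎)

  open IntegralDomain.Domain L 1≉0 integral public

  bijection⇒permutation : (g h : Carrier → Carrier) →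
    (∀ {x y} → x ≈ y → g x ≈ g y) → (∀ {x y} → x ≈ y → h x ≈ h y) →
    (∀ x → g (h x) ≈ x) → (∀ x → h (g x) ≈ x) → Permutation N N
  bijection⇒permutation g h g-cong h-cong gh hg = permutation
    (λ i → index (g (element i))) (λ i → index (h (element i)))
    (λ i → roundtrip g h g-cong gh i) (λ i → roundtrip h g h-cong hg i)
    where
    roundtrip : (g h : Carrier → Carrier) → (∀ {x y} → x ≈ y → g x ≈ g y) → (∀ x → g (h x) ≈ x) →
      ∀ i → index (g (element (index (h (element i))))) ≡ i
    roundtrip g h g-cong gh i = ≡.trans
      (index-cong (trans (g-cong (element-index _)) (gh (element i)))) (index-element i)

  -- Translation by `1#` permutes the field, so the sum `S` of all elements is unchanged when `1#`
  -- is added to each of the `N` summands.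
  order-annihilates : fromℕ N ≈ 0#
  order-annihilates = begin
    fromℕ N      ≈⟨ solve 2 (λ s n → n := (n :+ s) :- s) refl S (fromℕ N) ⟩
    (fromℕ N + S) + - S ≈⟨ +-congʳ shifted ⟩
    S + - S      ≈⟨ -‿inverseʳ S ⟩
    0# ∎
    where
    S = sum element
    π = bijection⇒permutation (λ z → 1# + z) (λ z → - 1# + z) +-congˡ +-congˡ
          (solve 1 (λ x → one :+ (:- one :+ x) := x) refl)
          (solve 1 (λ x → :- one :+ (one :+ x) := x) refl)
    shifted : fromℕ N + S ≈ S
    shifted = begin
      fromℕ N + S ≡⟨ ≡.cong (_+ S) (fromℕ≡· N) ⟩
      _ + S ≈⟨ +-congʳ (sum-replicate N) ⟨
      sum {N} (λ _ → 1#) + S ≈⟨ ∑-distrib-+ {N} (λ _ → 1#) element ⟨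
      sum (λ i → 1# + element i) ≈⟨ sum-cong-≋ {N} (λ i → element-index (1# + element i)) ⟨
      sum (λ i → element (π ⟨$⟩ʳ i)) ≈⟨ sum-permute element π ⟨
      S ∎

  private
    if0 : Carrier → Carrier → Carrier → Carrier
    if0 x a b with x ≟ 0#
    ... | yes _ = a
    ... | no _ = b

    if0-yes : ∀ {x a b} → x ≈ 0# → if0 x a b ≈ a
    if0-yes {x} x≈0 with x ≟ 0#
    ... | yes _ = refl
    ... | no x≉0 = contradiction x≈0 x≉0

    if0-no : ∀ {x a b} → x ≉ 0# → if0 x a b ≈ b
    if0-no {x} x≉0 with x ≟ 0#
    ... | yes x≈0 = contradiction x≈0 x≉0
    ... | no _ = refl

    prod-nonzero : ∀ n (t : Fin n → Carrier) → (∀ i → t i ≉ 0#) → prod t ≉ 0#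
    prod-nonzero zero t _ = 1≉0
    prod-nonzero (suc n) t t≉0 = *-nonzero (t≉0 zero) (prod-nonzero n (λ i → t (suc i)) (λ i → t≉0 (suc i)))

    prod-ones : ∀ n (t : Fin n → Carrier) → (∀ i → t i ≈ 1#) → prod t ≈ 1#
    prod-ones zero t _ = refl
    prod-ones (suc n) t t≈1 = trans (*-cong (t≈1 zero) (prod-ones n _ (λ i → t≈1 (suc i)))) (*-identityˡ 1#)

    prod-single : ∀ n (t : Fin n → Carrier) i → (∀ j → j ≢ i → t j ≈ 1#) → prod t ≈ t i
    prod-single (suc n) t zero t≈1 = trans (*-congˡ (prod-ones n _ (λ j → t≈1 (suc j) (λ ())))) (*-identityʳ _)
    prod-single (suc n) t (suc i) t≈1 = trans
      (*-cong (t≈1 zero (λ ())) (prod-single n _ i (λ j j≢i → t≈1 (suc j) (λ eq → j≢i (Fin.suc-injective eq)))))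
      (*-identityˡ _)

    module _ (a : Carrier) (a≉0 : a ≉ 0#) where
      -- g replaces 0 by 1, so that its product over the field is that of the units
      g h k : Carrier → Carrier
      g x = if0 x 1# x
      h x = if0 x 1# a
      k x = if0 x a 1#

      split : ∀ x → g (a * x) ≈ h x * g x
      split x with x ≟ 0#
      ... | yes x≈0 = trans (if0-yes (trans (*-congˡ x≈0) (zeroʳ a))) (sym (*-identityˡ 1#))
      ... | no x≉0 = if0-no (*-nonzero a≉0 x≉0)

      constant : ∀ x → h x * k x ≈ a
      constant x with x ≟ 0#
      ... | yes _ = *-identityˡ a
      ... | no _ = *-identityʳ a

      g≉0 : ∀ x → g x ≉ 0#
      g≉0 x with x ≟ 0#
      ... | yes _ = 1≉0
      ... | no x≉0 = x≉0

      g-cong : ∀ {x y} → x ≈ y → g x ≈ g y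
      g-cong {x} {y} eq with x ≟ 0#
      ... | yes x≈0 = sym (if0-yes (trans (sym eq) x≈0))
      ... | no x≉0 = trans eq (sym (if0-no (λ y≈0 → x≉0 (trans eq y≈0))))

      G H K : Carrier
      G = prod (λ i → g (element i))
      H = prod (λ i → h (element i))
      K = prod (λ i → k (element i))

      a⁻¹ = proj₁ (inverse a a≉0)

      π = bijection⇒permutation (a *_) (a⁻¹ *_) *-congˡ *-congˡ
            (λ x → trans (sym (*-assoc a a⁻¹ x)) (trans (*-congʳ aa⁻¹≈1) (*-identityˡ x)))
            (λ x → trans (sym (*-assoc a⁻¹ a x)) (trans (*-congʳ (trans (*-comm a⁻¹ a) aa⁻¹≈1)) (*-identityˡ x)))
        where aa⁻¹≈1 = proj₂ (inverse a a≉0)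

      -- Multiplication by `a` permutes the field and fixes 0, so the product `G` of the units
      -- equals `H * G`. Here `H` is `a` raised to the number of units.
      H≈1 : H ≈ 1#
      H≈1 = cancelˡ (prod-nonzero N _ (λ i → g≉0 (element i))) (begin
        G * H ≈⟨ *-comm G H ⟩
        H * G ≈⟨ prod-distrib {N} _ _ ⟨
        prod (λ i → h (element i) * g (element i)) ≈⟨ prod-cong {N} (λ i → split (element i)) ⟨
        prod (λ i → g (a * element i)) ≈⟨ prod-cong {N} (λ i → g-cong (element-index (a * element i))) ⟨
        prod (λ i → g (element (π ⟨$⟩ʳ i))) ≈⟨ prod-permute (λ i → g (element i)) π ⟨
        G ≈⟨ *-identityʳ G ⟨
        G * 1# ∎)

      K≈a : K ≈ a
      K≈a = trans
        (prod-single N _ (index 0#) λ j j≢0 → if0-no (λ eq → j≢0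
          (≡.trans (≡.sym (index-element j)) (index-cong eq))))
        (if0-yes (element-index 0#))

      -- The `N` factors `a` are split into those at the nonzero elements, with product `H`, and the
      -- one at 0, with product `K`. The units need not be enumerated separately.
      fermat-nonzero : pow a N ≈ a
      fermat-nonzero = begin
        pow a N ≡⟨ pow≡^ a N ⟩
        _ ≈⟨ prod-replicate N ⟨
        prod {N} (λ _ → a) ≈⟨ prod-cong {N} (λ i → constant (element i)) ⟨
        prod (λ i → h (element i) * k (element i)) ≈⟨ prod-distrib {N} _ _ ⟩
        H * K ≈⟨ *-cong H≈1 K≈a ⟩
        1# * a ≈⟨ *-identityˡ a ⟩
        a ∎

  fermat : ∀ x → pow x N ≈ x
  fermat x with x ≟ 0#
  ... | no x≉0 = fermat-nonzero x x≉0
  ... | yes x≈0 = trans (pow-cong N x≈0) (trans (pow-0 N (index 0#)) (sym x≈0))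
    where
    pow-0 : ∀ n → Fin n → pow 0# n ≈ 0#
    pow-0 (suc n) _ = zeroˡ _

  -- `N` vanishes and is a power of `p`, and a domain has no nonzero nilpotent elements.
  prime-annihilates : ∀ {p} m → N ≡ p ℕ.^ m → fromℕ p ≈ 0#
  prime-annihilates {p} m N≡pᵐ = pow≈0 m (trans (sym (fromℕ-^ m))
    (trans (reflexive (≡.cong fromℕ (≡.sym N≡pᵐ))) order-annihilates))
    where
    fromℕ-^ : ∀ m → fromℕ (p ℕ.^ m) ≈ pow (fromℕ p) m
    fromℕ-^ zero = +-identityʳ 1#
    fromℕ-^ (suc m) = trans (fromℕ-* p (p ℕ.^ m)) (*-congˡ (fromℕ-^ m))

  2≤N : 2 ℕ.≤ N
  2≤N = twoElements (index 0#) (index 1#) (λ eq → 1≉0 (sym (index-injective eq)))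
    where
    twoElements : ∀ {n} (i j : Fin n) → i ≢ j → 2 ℕ.≤ n
    twoElements {suc zero} zero zero i≢j = contradiction ≡.refl i≢j
    twoElements {suc (suc n)} _ _ _ = ℕ.s≤s (ℕ.s≤s ℕ.z≤n)

-- Ring endomorphisms, the Frobenius map, and conjugates of roots.

module Endomorphisms (R : CommutativeRing 0ℓ 0ℓ) where
  open CommutativeRing R hiding (zero)

  module RingEndomorphism
    (F : Carrier → Carrier)
    (F-cong : ∀ {x y} → x ≈ y → F x ≈ F y)
    (F-+ : ∀ x y → F (x + y) ≈ F x + F y)
    (F-* : ∀ x y → F (x * y) ≈ F x * F y)
    (F-1 : F 1# ≈ 1#) where
    open FieldTheory R
    open IntegerSolver R
    open Powers R
    open import Algebra.Properties.Monoid.Mult.TCOptimised +-monoid using (1+×) renaming (_×_ to _·_)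

    F-0 : F 0# ≈ 0#
    F-0 = trans (solve 1 (λ a → a := (a :+ a) :- a) refl (F 0#))
      (trans (+-congʳ (trans (sym (F-+ 0# 0#)) (F-cong (+-identityˡ 0#)))) (-‿inverseʳ _))

    F-neg : ∀ x → F (- x) ≈ - F x
    F-neg x = x+y≈0⇒x≈-y (trans (sym (F-+ (- x) x)) (trans (F-cong (-‿inverseˡ x)) F-0))

    private
      F-ℕ : ∀ n → F (n · 1#) ≈ n · 1#
      F-ℕ zero = F-0
      F-ℕ (suc n) = trans (F-cong (1+× n 1#)) (trans (F-+ _ _) (trans (+-cong F-1 (F-ℕ n)) (sym (1+× n 1#))))

    -- Conjugates a whole expression at once: integer coefficients are fixed, so only the images of
    -- the variables have to be supplied.
    F-poly : ∀ {n} (e : Polynomial n) {ρ ρ′} → Pointwise (λ x y → F x ≈ y) ρ ρ′ → F (⟦ e ⟧ ρ) ≈ ⟦ e ⟧ ρ′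
    F-poly (op [+] e e′) es = trans (F-+ _ _) (+-cong (F-poly e es) (F-poly e′ es))
    F-poly (op [*] e e′) es = trans (F-* _ _) (*-cong (F-poly e es) (F-poly e′ es))
    F-poly (con (+ n)) es = F-ℕ n
    F-poly (con -[1+ n ]) es = trans (F-neg _) (-‿cong (F-ℕ (suc n)))
    F-poly (var x) es = Pointwise.lookup es x
    F-poly (e :^ zero) es = F-1
    F-poly (e :^ suc n) es = trans (F-* _ _) (*-cong (F-poly e es) (F-poly (e :^ n) es))
    F-poly (:- e) es = trans (F-neg _) (-‿cong (F-poly e es))

    iterate : ℕ → Carrier → Carrier
    iterate zero x = x
    iterate (suc n) x = F (iterate n x)

    module Conjugates (integral : ∀ {x y} → x * y ≈ 0# → x ≈ 0# ⊎ y ≈ 0#)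
      (F≈0 : ∀ {x} → F x ≈ 0# → x ≈ 0#) where

      F-injective : ∀ {x y} → F x ≈ F y → x ≈ y
      F-injective {x} {y} eq = x-y≈0⇒x≈y (F≈0
        (trans (F-+ x (- y)) (trans (+-congˡ (F-neg y)) (x≈y⇒x-y≈0 eq))))

      square-root-conjugate : ∀ {ξ x} → F ξ ≈ ξ → x * x ≈ ξ → F x ≈ x ⊎ F x ≈ - x
      square-root-conjugate {ξ} {x} Fξ eq = Sum.map x-y≈0⇒x≈y x+y≈0⇒x≈-y (integral
        (trans (solve 2 (λ x y → (y :- x) :* (y :+ x) := y :* y :- x :* x) refl x (F x))
          (x≈y⇒x-y≈0 (trans (sym (F-* x x)) (trans (F-cong eq) (trans Fξ (sym eq)))))))

      module _ {σ : Carrier} (Fσ : F σ ≈ σ) where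
        Root : Carrier → Set
        Root u = u * (u * u) ≈ σ * u + 1#

        F-root : ∀ {u} → Root u → Root (F u)
        F-root {u} root = trans (sym (F-poly (var zero :* (var zero :* var zero)) (refl ∷ [])))
          (trans (F-cong root) (F-poly (var zero :* var (suc zero) :+ one) (Fσ ∷ refl ∷ [])))

        -- For `f = X³ - σX - 1` this is `(f(v) - f(u)) / (v - u)`; when `u` is a root it is
        -- `f(X) / (X - u)` evaluated at `v`.
        quotient : Carrier → Carrier → Carrier
        quotient u v = v * v + u * v + (u * u + - σ)

        distinct-roots : ∀ {u v} → Root u → Root v → u ≈ v ⊎ quotient u v ≈ 0#
        distinct-roots {u} {v} ru rv = Sum.map₁ x-y≈0⇒x≈y (integral
          (trans (solve 3 (λ u v s → (u :- v) :* (v :* v :+ u :* v :+ (u :* u :- s))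
                    := (u :* (u :* u) :- (s :* u :+ one)) :- (v :* (v :* v) :- (s :* v :+ one))) refl u v σ)
            (trans (+-cong (x≈y⇒x-y≈0 ru) (-‿cong (x≈y⇒x-y≈0 rv))) (-‿inverseʳ 0#))))

        -- If `u` differs from both `F u` and `F (F u)`, subtracting the two vanishing quotients
        -- leaves `F u - F (F u)` times the sum of the three conjugates. The first factor vanishes
        -- only if `F u` is `u`, by injectivity.
        root-conjugates : ∀ {u} → Root u →
          F u ≈ u ⊎ (F (F u) ≈ u × quotient u (F u) ≈ 0#) ⊎ u + F u + F (F u) ≈ 0#
        root-conjugates {u} ru =
          [ (λ u≈v → inj₁ (sym u≈v))
          , (λ e → [ (λ u≈w → inj₂ (inj₁ (sym u≈w , e)))
                   , (λ e′ → Sum.map (λ v-w≈0 → F-injective (sym (x-y≈0⇒x≈y v-w≈0))) inj₂ (integral (difference e e′)))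
                   ]′ (distinct-roots ru (F-root (F-root ru))))
          ]′ (distinct-roots ru (F-root ru))
          where
          difference : quotient u (F u) ≈ 0# → quotient u (F (F u)) ≈ 0# →
            (F u + - F (F u)) * (u + F u + F (F u)) ≈ 0#
          difference e e′ = trans
            (solve 4 (λ u v w s → (v :- w) :* (u :+ v :+ w)
               := (v :* v :+ u :* v :+ (u :* u :- s)) :- (w :* w :+ u :* w :+ (u :* u :- s)))
               refl u (F u) (F (F u)) σ)
            (trans (+-cong e (-‿cong e′)) (-‿inverseʳ 0#))

        trace-zero⇒F³ : ∀ {u} → u + F u + F (F u) ≈ 0# → F (F (F u)) ≈ u
        trace-zero⇒F³ {u} e = trans
          (solve 4 (λ u v w z → z := u :+ (v :+ w :+ z) :- (u :+ v :+ w)) refl u (F u) (F (F u)) (F (F (F u))))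
          (trans (+-cong (+-congˡ e′) (-‿cong e)) (solve 1 (λ u → u :+ zer :- zer := u) refl u))
          where
          e′ : F u + F (F u) + F (F (F u)) ≈ 0#
          e′ = trans (sym (F-poly (var zero :+ var (suc zero) :+ var (suc (suc zero))) (refl ∷ refl ∷ refl ∷ [])))
            (trans (F-cong e) F-0)

        -- `u` is fixed by `F`, by its square or by its cube, and 1, 2 and 3 all divide 6.
        root⇒F⁶ : ∀ {u} → Root u → iterate 6 u ≈ u
        root⇒F⁶ {u} ru = [ period₁ , [ (λ (e , _) → period₂ e) , (λ e → period₃ (trace-zero⇒F³ e)) ]′ ]′ (root-conjugates ru)
          where
          period₁ : F u ≈ u → iterate 6 u ≈ u
          period₁ e = trans (F-cong (F-cong (F-cong (F-cong (F-cong e))))) (trans (F-cong (F-cong (F-cong (F-cong e))))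
            (trans (F-cong (F-cong (F-cong e))) (trans (F-cong (F-cong e)) (trans (F-cong e) e))))

          period₂ : F (F u) ≈ u → iterate 6 u ≈ u
          period₂ e = trans (F-cong (F-cong (F-cong (F-cong e)))) (trans (F-cong (F-cong e)) e)

          period₃ : F (F (F u)) ≈ u → iterate 6 u ≈ u
          period₃ e = trans (F-cong (F-cong (F-cong e))) e

module Frobenius (R : CommutativeRing 0ℓ 0ℓ) {p} (pr : Prime p)
  (p≈0 : CommutativeRing._≈_ R (FieldTheory.fromℕ R p) (CommutativeRing.0# R)) (k : ℕ) where
  open CommutativeRing R hiding (zero)
  open FieldTheory R
  open Powers R
  open CharacteristicP pr p≈0

  F : Carrier → Carrier
  F x = pow x (p ℕ.^ k)

  F-cong : ∀ {x y} → x ≈ y → F x ≈ F y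
  F-cong = pow-cong (p ℕ.^ k)

  F-+ : ∀ x y → F (x + y) ≈ F x + F y
  F-+ = frobenius-+ k

  F-* : ∀ x y → F (x * y) ≈ F x * F y
  F-* x y = pow-* x y (p ℕ.^ k)

  F-1 : F 1# ≈ 1#
  F-1 = pow-1# (p ℕ.^ k)

  open Endomorphisms.RingEndomorphism R F F-cong F-+ F-* F-1 public

  pow-iterate : ∀ j x → pow x ((p ℕ.^ k) ℕ.^ j) ≈ iterate j x
  pow-iterate zero x = *-identityʳ x
  pow-iterate (suc j) x = trans (reflexive (≡.cong (pow x) (ℕ.*-comm (p ℕ.^ k) ((p ℕ.^ k) ℕ.^ j))))
    (trans (sym (pow-pow x ((p ℕ.^ k) ℕ.^ j) (p ℕ.^ k))) (F-cong (pow-iterate j x)))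

-- The rings L[X]/(X² - ξ) and L[X]/(X³ - σX - 1).

module AdjoinSquareRoot (L : CommutativeRing 0ℓ 0ℓ) (ξ : CommutativeRing.Carrier L) where
  open CommutativeRing L hiding (zero)
  open IntegerSolver L

  private
    additive = DirectProduct.abelianGroup +-abelianGroup +-abelianGroup
    module M = AbelianGroup additive

    infixl 7 _⊛_
    _⊛_ : M.Carrier → M.Carrier → M.Carrier
    (a , b) ⊛ (c , d) = a * c + ξ * (b * d) , a * d + b * c

    ⊛-comm : ∀ x y → x ⊛ y M.≈ y ⊛ x
    ⊛-comm (a , b) (c , d) =
      solve 5 (λ a b c d s → a :* c :+ s :* (b :* d) := c :* a :+ s :* (d :* b)) refl a b c d ξ ,
      solve 4 (λ a b c d → a :* d :+ b :* c := c :* b :+ d :* a) refl a b c d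

    ⊛-assoc : ∀ x y z → (x ⊛ y) ⊛ z M.≈ x ⊛ (y ⊛ z)
    ⊛-assoc (a , b) (c , d) (e , f) =
      solve 7 (λ a b c d e f s →
        (a :* c :+ s :* (b :* d)) :* e :+ s :* ((a :* d :+ b :* c) :* f)
        := a :* (c :* e :+ s :* (d :* f)) :+ s :* (b :* (c :* f :+ d :* e))) refl a b c d e f ξ ,
      solve 7 (λ a b c d e f s →
        (a :* c :+ s :* (b :* d)) :* f :+ (a :* d :+ b :* c) :* e
        := a :* (c :* f :+ d :* e) :+ b :* (c :* e :+ s :* (d :* f))) refl a b c d e f ξ

    ⊛-identityˡ : ∀ x → (1# , 0#) ⊛ x M.≈ x
    ⊛-identityˡ (a , b) =
      solve 3 (λ a b s → one :* a :+ s :* (zer :* b) := a) refl a b ξ ,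
      solve 2 (λ a b → one :* b :+ zer :* a := b) refl a b

    ⊛-distribˡ : ∀ x y z → x ⊛ (y M.∙ z) M.≈ (x ⊛ y) M.∙ (x ⊛ z)
    ⊛-distribˡ (a , b) (c , d) (e , f) =
      solve 7 (λ a b c d e f s → a :* (c :+ e) :+ s :* (b :* (d :+ f))
        := (a :* c :+ s :* (b :* d)) :+ (a :* e :+ s :* (b :* f))) refl a b c d e f ξ ,
      solve 6 (λ a b c d e f → a :* (d :+ f) :+ b :* (c :+ e)
        := (a :* d :+ b :* c) :+ (a :* f :+ b :* e)) refl a b c d e f

  ring[√ξ] : CommutativeRing 0ℓ 0ℓ
  ring[√ξ] = record
    { Carrier = M.Carrier ; _≈_ = M._≈_ ; _+_ = M._∙_ ; _*_ = _⊛_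
    ; -_ = M._⁻¹ ; 0# = M.ε ; 1# = 1# , 0#
    ; isCommutativeRing = record
      { isRing = record
        { +-isAbelianGroup = M.isAbelianGroup
        ; *-cong = λ (a≈ , b≈) (c≈ , d≈) →
            +-cong (*-cong a≈ c≈) (*-congˡ (*-cong b≈ d≈)) , +-cong (*-cong a≈ d≈) (*-cong b≈ c≈)
        ; *-assoc = ⊛-assoc
        ; *-identity = ⊛-identityˡ , λ x → M.trans (⊛-comm x _) (⊛-identityˡ x)
        ; distrib = ⊛-distribˡ , λ x y z → M.trans (⊛-comm (y M.∙ z) x)
            (M.trans (⊛-distribˡ x y z) (M.∙-cong (⊛-comm x y) (⊛-comm x z)))
        }
      ; *-comm = ⊛-comm
      }
    }

  scalar : Carrier → M.Carrier
  scalar a = a , 0#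

  √ξ : M.Carrier
  √ξ = 0# , 1#

  √ξ²≈ξ : √ξ ⊛ √ξ M.≈ scalar ξ
  √ξ²≈ξ = solve 1 (λ s → zer :* zer :+ s :* (one :* one) := s) refl ξ , solve 0 (zer :* one :+ one :* zer := zer) refl

  scalar-* : ∀ a b → scalar (a * b) M.≈ scalar a ⊛ scalar b
  scalar-* a b =
    solve 3 (λ a b s → a :* b := a :* b :+ s :* (zer :* zer)) refl a b ξ ,
    solve 2 (λ a b → zer := a :* zer :+ zer :* b) refl a b

module AdjoinCubicRoot (L : CommutativeRing 0ℓ 0ℓ) (σ : CommutativeRing.Carrier L) where
  open CommutativeRing L hiding (zero)
  open IntegerSolver L

  -- The coordinates of a product in solver syntax, so that nested products can be passed to
  -- `solve`.
  module Formal {n} (s : Polynomial n) where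
    c₀ c₁ c₂ : (a b c x y z : Polynomial n) → Polynomial n
    c₀ a b c x y z = a :* x :+ (b :* z :+ c :* y)
    c₁ a b c x y z = a :* y :+ b :* x :+ (s :* (b :* z :+ c :* y) :+ c :* z)
    c₂ a b c x y z = a :* z :+ b :* y :+ c :* x :+ s :* (c :* z)

  private
    additive = DirectProduct.abelianGroup +-abelianGroup (DirectProduct.abelianGroup +-abelianGroup +-abelianGroup)
    module M = AbelianGroup additive

    infixl 7 _⊛_
    -- A triple stands for `a₀ + a₁ θ + a₂ θ²`; products are reduced by `θ³ = σθ + 1` and
    -- `θ⁴ = σθ² + θ`.
    _⊛_ : M.Carrier → M.Carrier → M.Carrier
    (a₀ , a₁ , a₂) ⊛ (b₀ , b₁ , b₂) =
      a₀ * b₀ + (a₁ * b₂ + a₂ * b₁) ,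
      a₀ * b₁ + a₁ * b₀ + (σ * (a₁ * b₂ + a₂ * b₁) + a₂ * b₂) ,
      a₀ * b₂ + a₁ * b₁ + a₂ * b₀ + σ * (a₂ * b₂)

    ⊛-comm : ∀ x y → x ⊛ y M.≈ y ⊛ x
    ⊛-comm (a , b , c) (x , y , z) =
      solve 7 (λ a b c x y z s → let open Formal s in c₀ a b c x y z := c₀ x y z a b c) refl a b c x y z σ ,
      solve 7 (λ a b c x y z s → let open Formal s in c₁ a b c x y z := c₁ x y z a b c) refl a b c x y z σ ,
      solve 7 (λ a b c x y z s → let open Formal s in c₂ a b c x y z := c₂ x y z a b c) refl a b c x y z σ

    ⊛-assoc : ∀ x y z → (x ⊛ y) ⊛ z M.≈ x ⊛ (y ⊛ z)
    ⊛-assoc (a , b , c) (x , y , z) (u , v , w) =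
      solve 10 (λ a b c x y z u v w s → let open Formal s in
        c₀ (c₀ a b c x y z) (c₁ a b c x y z) (c₂ a b c x y z) u v w
        := c₀ a b c (c₀ x y z u v w) (c₁ x y z u v w) (c₂ x y z u v w)) refl a b c x y z u v w σ ,
      solve 10 (λ a b c x y z u v w s → let open Formal s in
        c₁ (c₀ a b c x y z) (c₁ a b c x y z) (c₂ a b c x y z) u v w
        := c₁ a b c (c₀ x y z u v w) (c₁ x y z u v w) (c₂ x y z u v w)) refl a b c x y z u v w σ ,
      solve 10 (λ a b c x y z u v w s → let open Formal s in
        c₂ (c₀ a b c x y z) (c₁ a b c x y z) (c₂ a b c x y z) u v w
        := c₂ a b c (c₀ x y z u v w) (c₁ x y z u v w) (c₂ x y z u v w)) refl a b c x y z u v w σ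

    ⊛-identityˡ : ∀ x → (1# , 0# , 0#) ⊛ x M.≈ x
    ⊛-identityˡ (a , b , c) =
      solve 4 (λ a b c s → let open Formal s in c₀ one zer zer a b c := a) refl a b c σ ,
      solve 4 (λ a b c s → let open Formal s in c₁ one zer zer a b c := b) refl a b c σ ,
      solve 4 (λ a b c s → let open Formal s in c₂ one zer zer a b c := c) refl a b c σ

    ⊛-distribˡ : ∀ x y z → x ⊛ (y M.∙ z) M.≈ (x ⊛ y) M.∙ (x ⊛ z)
    ⊛-distribˡ (a , b , c) (x , y , z) (u , v , w) =
      solve 10 (λ a b c x y z u v w s → let open Formal s in
        c₀ a b c (x :+ u) (y :+ v) (z :+ w) := c₀ a b c x y z :+ c₀ a b c u v w) refl a b c x y z u v w σ ,
      solve 10 (λ a b c x y z u v w s → let open Formal s in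
        c₁ a b c (x :+ u) (y :+ v) (z :+ w) := c₁ a b c x y z :+ c₁ a b c u v w) refl a b c x y z u v w σ ,
      solve 10 (λ a b c x y z u v w s → let open Formal s in
        c₂ a b c (x :+ u) (y :+ v) (z :+ w) := c₂ a b c x y z :+ c₂ a b c u v w) refl a b c x y z u v w σ

    ⊛-cong : ∀ {x x′ y y′} → x M.≈ x′ → y M.≈ y′ → x ⊛ y M.≈ x′ ⊛ y′
    ⊛-cong (a , b , c) (x , y , z) =
      +-cong (*-cong a x) bz+cy ,
      +-cong (+-cong (*-cong a y) (*-cong b x)) (+-cong (*-congˡ bz+cy) (*-cong c z)) ,
      +-cong (+-cong (+-cong (*-cong a z) (*-cong b y)) (*-cong c x)) (*-congˡ (*-cong c z))
      where bz+cy = +-cong (*-cong b z) (*-cong c y)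

  ring[θ] : CommutativeRing 0ℓ 0ℓ
  ring[θ] = record
    { Carrier = M.Carrier ; _≈_ = M._≈_ ; _+_ = M._∙_ ; _*_ = _⊛_
    ; -_ = M._⁻¹ ; 0# = M.ε ; 1# = 1# , 0# , 0#
    ; isCommutativeRing = record
      { isRing = record
        { +-isAbelianGroup = M.isAbelianGroup
        ; *-cong = ⊛-cong
        ; *-assoc = ⊛-assoc
        ; *-identity = ⊛-identityˡ , λ x → M.trans (⊛-comm x _) (⊛-identityˡ x)
        ; distrib = ⊛-distribˡ , λ x y z → M.trans (⊛-comm (y M.∙ z) x)
            (M.trans (⊛-distribˡ x y z) (M.∙-cong (⊛-comm x y) (⊛-comm x z)))
        }
      ; *-comm = ⊛-comm
      }
    }

  scalar : Carrier → M.Carrier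
  scalar a = a , 0# , 0#

  θ : M.Carrier
  θ = 0# , 1# , 0#

  θ³≈σθ+1 : θ ⊛ (θ ⊛ θ) M.≈ (scalar σ ⊛ θ) M.∙ (1# , 0# , 0#)
  θ³≈σθ+1 =
    solve 1 (λ s → let open Formal s in
      c₀ zer one zer (c₀ zer one zer zer one zer) (c₁ zer one zer zer one zer) (c₂ zer one zer zer one zer)
      := c₀ s zer zer zer one zer :+ one) refl σ ,
    solve 1 (λ s → let open Formal s in
      c₁ zer one zer (c₀ zer one zer zer one zer) (c₁ zer one zer zer one zer) (c₂ zer one zer zer one zer)
      := c₁ s zer zer zer one zer :+ zer) refl σ ,
    solve 1 (λ s → let open Formal s in
      c₂ zer one zer (c₀ zer one zer zer one zer) (c₁ zer one zer zer one zer) (c₂ zer one zer zer one zer)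
      := c₂ s zer zer zer one zer :+ zer) refl σ

  scalar-* : ∀ a b → scalar (a * b) M.≈ scalar a ⊛ scalar b
  scalar-* a b =
    solve 3 (λ a b s → let open Formal s in a :* b := c₀ a zer zer b zer zer) refl a b σ ,
    solve 3 (λ a b s → let open Formal s in zer := c₁ a zer zer b zer zer) refl a b σ ,
    solve 3 (λ a b s → let open Formal s in zer := c₂ a zer zer b zer zer) refl a b σ

-- Existence in L of square roots and of roots of the cubic.

module FieldOfOrderQ⁶ {p} (pr : Prime p) (k : ℕ) (L : CommutativeRing 0ℓ 0ℓ)
  (isFiniteField : FieldTheory.IsFiniteFieldOfOrder L ((p ℕ.^ k) ℕ.^ 6)) where
  open CommutativeRing L hiding (zero)
  open FieldTheory L
  open IntegerSolver L
  open Powers L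
  open FiniteField L ((p ℕ.^ k) ℕ.^ 6) isFiniteField

  p≈0 : fromℕ p ≈ 0#
  p≈0 = prime-annihilates (k ℕ.* 6) (ℕ.^-*-assoc p k 6)

  open Frobenius L pr p≈0 k

  F⁶ : ∀ x → iterate 6 x ≈ x
  F⁶ x = trans (sym (pow-iterate 6 x)) (fermat x)

  module Extensions (M : CommutativeRing 0ℓ 0ℓ) where
    private module M = CommutativeRing M

    -- Shared by both adjunctions: the root count asks only that `M` be a domain containing `L`, and
    -- not that it be a finite field.
    module Extension
      (integralᴹ : ∀ {x y} → x M.* y M.≈ M.0# → x M.≈ M.0# ⊎ y M.≈ M.0#)
      (scalar : Carrier → M.Carrier)
      (scalar-injective : ∀ {a b} → scalar a M.≈ scalar b → a ≈ b)
      (scalar-cong : ∀ {a b} → a ≈ b → scalar a M.≈ scalar b)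
      (scalar-+ : ∀ a b → scalar (a + b) M.≈ scalar a M.+ scalar b)
      (scalar-* : ∀ a b → scalar (a * b) M.≈ scalar a M.* scalar b)
      (scalar-0 : scalar 0# M.≈ M.0#)
      (scalar-1 : scalar 1# M.≈ M.1#) where
      private
        module FTᴹ = FieldTheory M
        module Pᴹ = Powers M

      scalar-pow : ∀ a n → scalar (pow a n) M.≈ FTᴹ.pow (scalar a) n
      scalar-pow a zero = scalar-1
      scalar-pow a (suc n) = M.trans (scalar-* a (pow a n)) (M.*-congˡ (scalar-pow a n))

      scalar-fromℕ : ∀ n → scalar (fromℕ n) M.≈ FTᴹ.fromℕ n
      scalar-fromℕ zero = scalar-0
      scalar-fromℕ (suc n) = M.trans (scalar-+ 1# (fromℕ n)) (M.+-cong scalar-1 (scalar-fromℕ n))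

      1≉0ᴹ : M.1# M.≉ M.0#
      1≉0ᴹ eq = 1≉0 (scalar-injective (M.trans scalar-1 (M.trans eq (M.sym scalar-0))))

      p≈0ᴹ : FTᴹ.fromℕ p M.≈ M.0#
      p≈0ᴹ = M.trans (M.sym (scalar-fromℕ p)) (M.trans (scalar-cong p≈0) scalar-0)

      module Fᴹ = Frobenius M pr p≈0ᴹ k
      module Dᴹ = IntegralDomain.Domain M 1≉0ᴹ integralᴹ
      module Cᴹ = Fᴹ.Conjugates integralᴹ (Dᴹ.pow≈0 (p ℕ.^ k))

      scalar-fixed : ∀ {a} → F a ≈ a → Fᴹ.F (scalar a) M.≈ scalar a
      scalar-fixed {a} Fa≈a = M.trans (M.sym (scalar-pow a (p ℕ.^ k))) (scalar-cong Fa≈a)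

      F⁶-fixed⇒scalar : ∀ {x} → (∀ a → scalar a M.≉ x) → Fᴹ.iterate 6 x M.≈ x → ⊥
      F⁶-fixed⇒scalar {x} x≉scalar eq = Dᴹ.pow-fixed-bound 2≤N roots roots-injective fixed
        where
        roots : Fin (suc ((p ℕ.^ k) ℕ.^ 6)) → M.Carrier
        roots zero = x
        roots (suc i) = scalar (element i)

        roots-injective : ∀ i j → roots i M.≈ roots j → i ≡ j
        roots-injective zero zero _ = ≡.refl
        roots-injective zero (suc j) e = contradiction (M.sym e) (x≉scalar _)
        roots-injective (suc i) zero e = contradiction e (x≉scalar _)
        roots-injective (suc i) (suc j) e = ≡.cong suc (element-injective i j (scalar-injective e))

        fixed : ∀ i → FTᴹ.pow (roots i) ((p ℕ.^ k) ℕ.^ 6) M.≈ roots i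
        fixed zero = M.trans (Fᴹ.pow-iterate 6 x) eq
        fixed (suc i) = M.trans (M.sym (scalar-pow (element i) ((p ℕ.^ k) ℕ.^ 6))) (scalar-cong (fermat (element i)))

  module SquareRoot {ξ : Carrier} (Fξ : F ξ ≈ ξ) where
    open AdjoinSquareRoot L ξ
    private module M = CommutativeRing ring[√ξ]

    module _ (nonsquare : ∀ z → z * z ≉ ξ) where
      -- This is the norm of `a + b√ξ`. If it vanished with `b` nonzero, `a / b` would be a square
      -- root of `ξ`.
      norm≉0 : ∀ a b → ¬ (a ≈ 0# × b ≈ 0#) → a * a + - (ξ * (b * b)) ≉ 0#
      norm≉0 a b ab≉0 n≈0 with b ≟ 0#
      ... | yes b≈0 = ab≉0 (Sum.reduce (integral a*a≈0) , b≈0)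
        where
        a*a≈0 : a * a ≈ 0#
        a*a≈0 = trans (x-y≈0⇒x≈y n≈0) (trans (*-congˡ (trans (*-congˡ b≈0) (zeroʳ b))) (zeroʳ ξ))
      ... | no b≉0 = nonsquare (a * b⁻¹) (trans
        (solve 2 (λ a c → (a :* c) :* (a :* c) := (a :* a) :* (c :* c)) refl a b⁻¹)
        (trans (*-congʳ (x-y≈0⇒x≈y n≈0))
        (trans (solve 3 (λ s b c → s :* (b :* b) :* (c :* c) := s :* ((b :* c) :* (b :* c))) refl ξ b b⁻¹)
          (trans (*-congˡ (trans (*-cong bb⁻¹≈1 bb⁻¹≈1) (*-identityˡ 1#))) (*-identityʳ ξ)))))
        where
        b⁻¹ = proj₁ (inverse b b≉0)
        bb⁻¹≈1 = proj₂ (inverse b b≉0)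

      integralᴹ : ∀ {x y} → x M.* y M.≈ M.0# → x M.≈ M.0# ⊎ y M.≈ M.0#
      integralᴹ {a , b} {c , d} (e , f) with (a ≟ 0#) ×-dec (b ≟ 0#)
      ... | yes ab≈0 = inj₁ ab≈0
      -- Multiplying the product by the conjugate `a - b√ξ` leaves the nonzero norm times `c` and
      -- times `d`.
      ... | no ab≉0 = inj₂ (cancel (modulo₂ e f
              (solve 5 (λ a b c d s → (a :* a :- s :* (b :* b)) :* c := zer
                :+ a :* (a :* c :+ s :* (b :* d) :- zer) :+ (:- (s :* b)) :* (a :* d :+ b :* c :- zer)) refl a b c d ξ))
            , cancel (modulo₂ e f
              (solve 5 (λ a b c d s → (a :* a :- s :* (b :* b)) :* d := zer
                :+ (:- b) :* (a :* c :+ s :* (b :* d) :- zer) :+ a :* (a :* d :+ b :* c :- zer)) refl a b c d ξ)))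
        where
        cancel : ∀ {z} → (a * a + - (ξ * (b * b))) * z ≈ 0# → z ≈ 0#
        cancel eq = cancelˡ (norm≉0 a b ab≉0) (trans eq (sym (zeroʳ _)))

      open Extensions.Extension ring[√ξ] integralᴹ scalar proj₁ (_, refl) (λ _ _ → refl , sym (+-identityˡ 0#))
        scalar-* M.refl M.refl

      nonsquare⇒⊥ : ⊥
      nonsquare⇒⊥ = F⁶-fixed⇒scalar (λ a (_ , 0≈1) → 1≉0 (sym 0≈1))
        ([ (λ e → F²⇒F⁶ (M.trans (Fᴹ.F-cong e) e))
         , (λ e → F²⇒F⁶ (M.trans (Fᴹ.F-cong e) (M.trans (Fᴹ.F-neg √ξ) (M.trans (M.-‿cong e) (-‿involutiveᴹ √ξ)))))
         ]′ (Cᴹ.square-root-conjugate (scalar-fixed Fξ) √ξ²≈ξ))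
        where
        open import Algebra.Properties.Ring M.ring using () renaming (-‿involutive to -‿involutiveᴹ)

        F²⇒F⁶ : ∀ {x} → Fᴹ.F (Fᴹ.F x) M.≈ x → Fᴹ.iterate 6 x M.≈ x
        F²⇒F⁶ e = M.trans (Fᴹ.F-cong (Fᴹ.F-cong (Fᴹ.F-cong (Fᴹ.F-cong e)))) (M.trans (Fᴹ.F-cong (Fᴹ.F-cong e)) e)

  -- The extension argument refutes only the absence of a root; exhaustive search in `L` then
  -- produces one.
  square-root : ∀ {ξ} → F ξ ≈ ξ → Σ Carrier λ η → η * η ≈ ξ
  square-root {ξ} Fξ = decidable-stable
    (search (λ eq e → trans (*-cong (sym eq) (sym eq)) e) (λ z → z * z ≟ ξ))
    (λ ∄ → SquareRoot.nonsquare⇒⊥ Fξ (λ z e → ∄ (z , e)))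

  module CubicRoot {σ : Carrier} (Fσ : F σ ≈ σ) where
    open AdjoinCubicRoot L σ
    private module M = CommutativeRing ring[θ]

    Root : Carrier → Set
    Root t = t * (t * t) ≈ σ * t + 1#

    module _ (rootless : ∀ t → ¬ Root t) where
      -- Invertibility without division: some multiple of `x` is a nonzero element of `L`, so `x`
      -- can be cancelled.
      ScalarMultiple : M.Carrier → Set
      ScalarMultiple x = Σ M.Carrier λ z → Σ Carrier λ n → n ≉ 0# × z M.* x M.≈ scalar n

      resp : ∀ {x y} → x M.≈ y → ScalarMultiple x → ScalarMultiple y
      resp x≈y (z , n , n≉0 , e) = z , n , n≉0 , M.trans (M.*-congˡ (M.sym x≈y)) e

      divisor : ∀ {x y} z → z M.* x M.≈ y → ScalarMultiple y → ScalarMultiple x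
      divisor z zx≈y (w , n , n≉0 , e) = w M.* z , n , n≉0 ,
        M.trans (M.*-assoc w z _) (M.trans (M.*-congˡ zx≈y) e)

      constant : ∀ a → a ≉ 0# → ScalarMultiple (a , 0# , 0#)
      constant a a≉0 = M.1# , a , a≉0 , M.*-identityˡ _

      -- The cofactor is the product of the other two formal conjugates of `a + bθ`, and `n` is the
      -- norm `-b³ f(-a / b)` for `f = X³ - σX - 1`. If `n` vanished, `-a / b` would be a root.
      linear : ∀ a b → b ≉ 0# → ScalarMultiple (a , b , 0#)
      linear a b b≉0 = (a * a + - (σ * (b * b)) , - (a * b) , b * b) , n , n≉0 ,
        (solve 3 (λ a b s → let open Formal s in
           c₀ (a :* a :- s :* (b :* b)) (:- (a :* b)) (b :* b) a b zer := N a b s) refl a b σ ,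
         solve 3 (λ a b s → let open Formal s in
           c₁ (a :* a :- s :* (b :* b)) (:- (a :* b)) (b :* b) a b zer := zer) refl a b σ ,
         solve 3 (λ a b s → let open Formal s in
           c₂ (a :* a :- s :* (b :* b)) (:- (a :* b)) (b :* b) a b zer := zer) refl a b σ)
        where
        N : ∀ {n} (a b s : Polynomial n) → Polynomial n
        N a b s = a :* (a :* a) :+ b :* (b :* b) :- s :* (a :* (b :* b))

        n = a * (a * a) + b * (b * b) + - (σ * (a * (b * b)))
        c = proj₁ (inverse b b≉0)

        n≉0 : n ≉ 0#
        n≉0 n≈0 = rootless (- (a * c)) (modulo₂ n≈0 (proj₂ (inverse b b≉0))
          (solve 4 (λ a b c s → let t = :- (a :* c); w = b :* c in
            t :* (t :* t) := (s :* t :+ one) :+ (:- (c :* (c :* c))) :* (N a b s :- zer)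
              :+ (w :* w :+ w :+ one :- s :* (a :* c) :* (w :+ one)) :* (w :- one)) refl a b c σ))

      -- One Euclidean step: `(cX - b)(a + bX + cX²)` equals `c² f` plus `r₀ + r₁ X`, which reduces
      -- to smaller degree. Were both `r₀` and `r₁` zero, `b / c` would be a root of `f`.
      quadratic : ∀ a b c → c ≉ 0# → ScalarMultiple (a , b , c)
      quadratic a b c c≉0 = divisor (- b , c , 0#)
          ( solve 4 (λ a b c s → let open Formal s in c₀ (:- b) c zer a b c := R₀ a b c) refl a b c σ
          , solve 4 (λ a b c s → let open Formal s in c₁ (:- b) c zer a b c := R₁ a b c s) refl a b c σ
          , solve 4 (λ a b c s → let open Formal s in c₂ (:- b) c zer a b c := zer) refl a b c σ)
          remainder
        where
        R₀ : ∀ {n} (a b c : Polynomial n) → Polynomial n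
        R₀ a b c = c :* c :- a :* b

        R₁ : ∀ {n} (a b c s : Polynomial n) → Polynomial n
        R₁ a b c s = s :* (c :* c) :+ c :* a :- b :* b

        r₀ = c * c + - (a * b)
        r₁ = σ * (c * c) + c * a + - (b * b)
        d = proj₁ (inverse c c≉0)

        remainder : ScalarMultiple (r₀ , r₁ , 0#)
        remainder with r₁ ≟ 0# | r₀ ≟ 0#
        ... | no r₁≉0 | _ = linear r₀ r₁ r₁≉0
        ... | yes r₁≈0 | no r₀≉0 = resp (refl , sym r₁≈0 , refl) (constant r₀ r₀≉0)
        ... | yes r₁≈0 | yes r₀≈0 = contradiction
          (modulo₃ r₀≈0 r₁≈0 (proj₂ (inverse c c≉0))
            (solve 5 (λ a b c d s → let t = b :* d; w = c :* d; d³ = d :* (d :* d) in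
              t :* (t :* t) := (s :* t :+ one) :+ (:- (d³ :* c)) :* (R₀ a b c :- zer)
                :+ (:- (d³ :* b)) :* (R₁ a b c s :- zer)
                :+ (w :* w :+ w :+ one :+ s :* t :* (w :+ one)) :* (w :- one)) refl a b c d σ))
          (rootless (b * d))

      scalarMultiple : ∀ x → ¬ (x M.≈ M.0#) → ScalarMultiple x
      scalarMultiple (a , b , c) x≉0 with c ≟ 0# | b ≟ 0# | a ≟ 0#
      ... | no c≉0 | _ | _ = quadratic a b c c≉0
      ... | yes c≈0 | no b≉0 | _ = resp (refl , refl , sym c≈0) (linear a b b≉0)
      ... | yes c≈0 | yes b≈0 | no a≉0 = resp (refl , sym b≈0 , sym c≈0) (constant a a≉0)
      ... | yes c≈0 | yes b≈0 | yes a≈0 = contradiction (a≈0 , b≈0 , c≈0) x≉0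

      scalarMultiple⇒cancel : ∀ {x y} → ScalarMultiple x → x M.* y M.≈ M.0# → y M.≈ M.0#
      scalarMultiple⇒cancel {x} {y@(a , b , c)} (z , n , n≉0 , zx≈n) xy≈0 =
        cancel (trans (solve 5 (λ n a b c s → let open Formal s in n :* a := c₀ n zer zer a b c) refl n a b c σ) (proj₁ ny≈0)) ,
        cancel (trans (solve 5 (λ n a b c s → let open Formal s in n :* b := c₁ n zer zer a b c) refl n a b c σ) (proj₁ (proj₂ ny≈0))) ,
        cancel (trans (solve 5 (λ n a b c s → let open Formal s in n :* c := c₂ n zer zer a b c) refl n a b c σ) (proj₂ (proj₂ ny≈0)))
        where
        ny≈0 : scalar n M.* y M.≈ M.0#
        ny≈0 = M.trans (M.*-congʳ (M.sym zx≈n)) (M.trans (M.*-assoc z x y) (M.trans (M.*-congˡ xy≈0) (M.zeroʳ z)))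

        cancel : ∀ {x} → n * x ≈ 0# → x ≈ 0#
        cancel eq = cancelˡ n≉0 (trans eq (sym (zeroʳ n)))

      integralᴹ : ∀ {x y} → x M.* y M.≈ M.0# → x M.≈ M.0# ⊎ y M.≈ M.0#
      integralᴹ {x@(a , b , c)} xy≈0 with (a ≟ 0#) ×-dec (b ≟ 0#) ×-dec (c ≟ 0#)
      ... | yes x≈0 = inj₁ x≈0
      ... | no x≉0 = inj₂ (scalarMultiple⇒cancel (scalarMultiple x x≉0) xy≈0)

      open Extensions.Extension ring[θ] integralᴹ scalar proj₁ (_, refl , refl)
        (λ _ _ → refl , sym (+-identityˡ 0#) , sym (+-identityˡ 0#)) scalar-* M.refl M.refl

      rootless⇒⊥ : ⊥
      rootless⇒⊥ = F⁶-fixed⇒scalar (λ a (_ , 0≈1 , _) → 1≉0 (sym 0≈1))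
        (Cᴹ.root⇒F⁶ (scalar-fixed Fσ) θ³≈σθ+1)

  cubic-root : ∀ {σ} → F σ ≈ σ → Σ Carrier λ u → u * (u * u) ≈ σ * u + 1#
  cubic-root {σ} Fσ = decidable-stable
    (search (λ eq e → trans (*-cong (sym eq) (*-cong (sym eq) (sym eq))) (trans e (+-congʳ (*-congˡ eq))))
      (λ t → t * (t * t) ≟ σ * t + 1#))
    (λ ∄ → CubicRoot.rootless⇒⊥ Fσ (λ t e → ∄ (t , e)))

-- A cubic without roots in F_q, and its conjugate roots in L.

module CubicGenerator {p} (pr : Prime p) (k : ℕ) (L : CommutativeRing 0ℓ 0ℓ)
  (isFiniteField : FieldTheory.IsFiniteFieldOfOrder L ((p ℕ.^ k) ℕ.^ 6)) where
  open CommutativeRing L hiding (zero)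
  open IntegerSolver L
  open Powers L
  open FiniteField L ((p ℕ.^ k) ℕ.^ 6) isFiniteField
  open FieldOfOrderQ⁶ pr k L isFiniteField
  open Frobenius L pr p≈0 k
  open Conjugates integral (pow≈0 (p ℕ.^ k))
  open import Algebra.Properties.Ring ring using (-‿involutive)

  HasRoot : Carrier → Set
  HasRoot σ = Σ Carrier λ t → F t ≈ t × t * (t * t) ≈ σ * t + 1#

  hasRoot? : ∀ σ → Dec (HasRoot σ)
  hasRoot? σ = search
    (λ eq (Ft , e) → trans (F-cong (sym eq)) (trans Ft eq) ,
      trans (*-cong (sym eq) (*-cong (sym eq) (sym eq))) (trans e (+-congʳ (*-congˡ eq))))
    (λ t → (F t ≟ t) ×-dec (t * (t * t) ≟ σ * t + 1#))

  root≉0 : ∀ {σ t} → t * (t * t) ≈ σ * t + 1# → t ≉ 0#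
  root≉0 {σ} {t} e t≈0 = 1≉0 (modulo₂ e t≈0
    (solve 2 (λ s t → one := zer :+ (:- one) :* (t :* (t :* t) :- (s :* t :+ one))
      :+ (t :* t :- s) :* (t :- zer)) refl σ t))

  root-determines-σ : ∀ {σ σ′ t t′} → t ≈ t′ → t * (t * t) ≈ σ * t + 1# → t′ * (t′ * t′) ≈ σ′ * t′ + 1# → σ ≈ σ′
  root-determines-σ {σ} {σ′} {t} {t′} t≈t′ e e′ = cancelˡ (root≉0 e) (modulo₃ e e′ t≈t′
    (solve 4 (λ s s′ t t′ → t :* s := t :* s′
      :+ (:- one) :* (t :* (t :* t) :- (s :* t :+ one))
      :+ one :* (t′ :* (t′ :* t′) :- (s′ :* t′ :+ one))
      :+ (t :* t :+ t :* t′ :+ t′ :* t′ :- s′) :* (t :- t′)) refl σ σ′ t t′))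

  -- A root t determines σ = t² - 1/t, and t ≠ 0; so if every cubic had a root in F_q,
  -- then F_q would inject into F_q minus a point.
  rootless-exists : Σ Carrier λ σ → F σ ≈ σ × ¬ HasRoot σ
  rootless-exists = decidable-stable
    (search (λ eq (Fσ , ∄) → trans (F-cong (sym eq)) (trans Fσ eq) ,
               λ (t , Ft , e) → ∄ (t , Ft , trans e (+-congʳ (*-congʳ (sym eq)))))
            (λ σ → (F σ ≟ σ) ×-dec ¬? (hasRoot? σ)))
    (λ ∄ → impossible (λ σ Fσ → decidable-stable (hasRoot? σ) (λ ∄t → ∄ (σ , Fσ , ∄t))))
    where
    impossible : (∀ σ → F σ ≈ σ → HasRoot σ) → ⊥
    impossible root = ℕ.1+n≰n (Fin.injective⇒≤ {f = index∘value} index∘value-injective)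
      where
      select : ∀ x → Dec (F x ≈ x) → Carrier
      select x (yes Fx) = proj₁ (root x Fx)
      -- The identity outside F_q extends the injection to all of `L`, so the pigeonhole principle
      -- applies to the given enumeration of `L`; 0 stays outside the image.
      select x (no _) = x

      select≉0 : ∀ x d → select x d ≉ 0#
      select≉0 x (yes Fx) = root≉0 (proj₂ (proj₂ (root x Fx)))
      select≉0 x (no ¬Fx) x≈0 = ¬Fx (trans (F-cong x≈0) (trans F-0 (sym x≈0)))

      select-injective : ∀ x y d e → select x d ≈ select y e → x ≈ y
      select-injective x y (yes Fx) (yes Fy) eq =
        root-determines-σ eq (proj₂ (proj₂ (root x Fx))) (proj₂ (proj₂ (root y Fy)))
      select-injective x y (yes Fx) (no ¬Fy) eq =
        contradiction (trans (F-cong (sym eq)) (trans (proj₁ (proj₂ (root x Fx))) eq)) ¬Fy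
      select-injective x y (no ¬Fx) (yes Fy) eq =
        contradiction (trans (F-cong eq) (trans (proj₁ (proj₂ (root y Fy))) (sym eq))) ¬Fx
      select-injective x y (no _) (no _) eq = eq

      decide : ∀ i → Dec (F (element i) ≈ element i)
      decide i = F (element i) ≟ element i

      value : Fin (suc ((p ℕ.^ k) ℕ.^ 6)) → Carrier
      value zero = 0#
      value (suc i) = select (element i) (decide i)

      index∘value : Fin (suc ((p ℕ.^ k) ℕ.^ 6)) → Fin ((p ℕ.^ k) ℕ.^ 6)
      index∘value i = index (value i)

      value-injective : ∀ i j → value i ≈ value j → i ≡ j
      value-injective zero zero _ = ≡.refl
      value-injective zero (suc j) eq = contradiction (sym eq) (select≉0 (element j) (decide j))
      value-injective (suc i) zero eq = contradiction eq (select≉0 (element i) (decide i))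
      value-injective (suc i) (suc j) eq =
        ≡.cong suc (element-injective i j (select-injective (element i) (element j) (decide i) (decide j) eq))

      index∘value-injective : Injective _≡_ _≡_ index∘value
      index∘value-injective eq = value-injective _ _ (index-injective eq)

  σ : Carrier
  σ = proj₁ rootless-exists

  Fσ : F σ ≈ σ
  Fσ = proj₁ (proj₂ rootless-exists)

  σ≉0 : σ ≉ 0#
  σ≉0 σ≈0 = proj₂ (proj₂ rootless-exists) (1# , F-1 , modulo σ≈0
    (solve 1 (λ s → one :* (one :* one) := (s :* one :+ one) :+ (:- one) :* (s :- zer)) refl σ))

  u : Carrier
  u = proj₁ (cubic-root Fσ)

  u-root : u * (u * u) ≈ σ * u + 1#
  u-root = proj₂ (cubic-root Fσ)

  Fu≉u : F u ≉ u
  Fu≉u Fu = proj₂ (proj₂ rootless-exists) (u , Fu , u-root)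

  -- `u` is not fixed by `F`. If `F` merely exchanged `u` and `F u`, the third root `-(u + F u)`
  -- would be fixed by `F`, against the choice of `σ`.
  u-trace : u + F u + F (F u) ≈ 0#
  u-trace = [ (λ e → contradiction e Fu≉u)
    , [ (λ (e , g) → contradiction (third-root e g) (proj₂ (proj₂ rootless-exists))) , (λ e → e) ]′
    ]′ (root-conjugates Fσ u-root)
    where
    third-root : F (F u) ≈ u → quotient Fσ u (F u) ≈ 0# → HasRoot σ
    third-root e g = - (u + F u) ,
      trans (F-neg (u + F u)) (-‿cong (trans (F-+ u (F u)) (trans (+-congˡ e) (+-comm (F u) u)))) ,
      modulo₂ u-root g (solve 3 (λ u v s → let z = :- (u :+ v) in z :* (z :* z) := s :* z :+ one
        :+ one :* (u :* (u :* u) :- (s :* u :+ one))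
        :+ (:- (u :+ u :+ v)) :* (v :* v :+ u :* v :+ (u :* u :- s) :- zer)) refl u (F u) σ)

-- Isotopy through a common isotope.

module Isotopism {A B S : Alg} where
  private
    module A = Alg A
    module B = Alg B
    module S = Alg S

  module ThroughCommonIsotope
    (isEquivalence : IsEquivalence S._≈_)
    (total : ∀ x → S.In x)
    (⊕-cong : ∀ {x x′ y y′} → x S.≈ x′ → y S.≈ y′ → (x S.⊕ y) S.≈ (x′ S.⊕ y′))
    (⊙-cong : ∀ {x x′ y y′} → x S.≈ x′ → y S.≈ y′ → (x S.⊙ y) S.≈ (x′ S.⊙ y′))
    (B-⊕ : ∀ x y → B.In x → B.In y → B.In (x B.⊕ y))
    (B-⊙ : ∀ x y → B.In x → B.In y → B.In (x B.⊙ y)) where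
    private
      open IsEquivalence isEquivalence using (sym; trans)

      module Lift (f : LinBij A S) (g : LinBij B S) where
        module f = LinBij f
        module g = LinBij g

        lift : A.A → B.A
        lift x = proj₁ (g.surj (f.fun x) (total _))

        lift-In : ∀ x → B.In (lift x)
        lift-In x = proj₁ (proj₂ (g.surj (f.fun x) (total _)))

        g∘lift : ∀ x → g.fun (lift x) S.≈ f.fun x
        g∘lift x = proj₂ (proj₂ (g.surj (f.fun x) (total _)))

        linBij : LinBij A B
        linBij = record
          { fun = lift
          ; pres = λ x _ → lift-In x
          ; cong = λ x y Ix Iy x≈y → g.inj _ _ (lift-In x) (lift-In y)
              (trans (g∘lift x) (trans (f.cong x y Ix Iy x≈y) (sym (g∘lift y))))
          ; add = λ x y Ix Iy → g.inj _ _ (lift-In (x A.⊕ y)) (B-⊕ _ _ (lift-In x) (lift-In y))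
              (trans (g∘lift (x A.⊕ y)) (trans (f.add x y Ix Iy)
                (trans (⊕-cong (sym (g∘lift x)) (sym (g∘lift y)))
                  (sym (g.add _ _ (lift-In x) (lift-In y))))))
          ; inj = λ x y Ix Iy e → f.inj x y Ix Iy (trans (sym (g∘lift x))
              (trans (g.cong _ _ (lift-In x) (lift-In y) e) (g∘lift y)))
          ; surj = λ y Iy → let (x , Ix , e) = f.surj (g.fun y) (total _) in
              x , Ix , g.inj _ _ (lift-In x) Iy (trans (g∘lift x) e)
          }

    -- Each component is a map to `S` followed by preimages chosen through `surj`. Injectivity makes
    -- the choice additive and compatible with equality; as `inj` speaks only of elements satisfying
    -- `In`, `B` has to be closed under its operations.
    common-isotope : Isotopic A S → Isotopic B S → Isotopic A B
    common-isotope (f₁ , f₂ , f₃ , f-iso) (g₁ , g₂ , g₃ , g-iso) =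
      L₁.linBij , L₂.linBij , L₃.linBij , λ x y Ix Iy →
        L₁.g.inj _ _ (L₁.lift-In _) (B-⊙ _ _ (L₂.lift-In x) (L₃.lift-In y))
          (trans (L₁.g∘lift _) (trans (f-iso x y Ix Iy)
            (trans (⊙-cong (sym (L₂.g∘lift x)) (sym (L₃.g∘lift y)))
              (sym (g-iso _ _ (L₂.lift-In x) (L₃.lift-In y))))))
      where
      module L₁ = Lift f₁ g₁
      module L₂ = Lift f₂ g₂
      module L₃ = Lift f₃ g₃

-- The basis 1, u, u² of L over F_{q²}, and the target coordinates.

module CubicExtension (L : CommutativeRing 0ℓ 0ℓ) where
  open CommutativeRing L hiding (zero)
  open FieldTheory L

  module CubicBasis
    (1≉0 : 1# ≉ 0#)
    (integral : ∀ {x y} → x * y ≈ 0# → x ≈ 0# ⊎ y ≈ 0#)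
    (inverse : ∀ x → x ≉ 0# → Σ Carrier λ y → x * y ≈ 1#)
    (F : Carrier → Carrier)
    (F-cong : ∀ {x y} → x ≈ y → F x ≈ F y)
    (F-+ : ∀ x y → F (x + y) ≈ F x + F y)
    (F-* : ∀ x y → F (x * y) ≈ F x * F y)
    (F-1 : F 1# ≈ 1#)
    (F≈0 : ∀ {x} → F x ≈ 0# → x ≈ 0#)
    (F⁶ : ∀ x → F (F (F (F (F (F x))))) ≈ x)
    (_≟_ : ∀ x y → Dec (x ≈ y))
    (square-root : ∀ {ξ} → F ξ ≈ ξ → Σ Carrier λ η → η * η ≈ ξ)
    (½ : Carrier) (½+½≈1 : ½ + ½ ≈ 1#)
    (σ u : Carrier) (Fσ : F σ ≈ σ)
    (u-root : u * (u * u) ≈ σ * u + 1#)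
    (Fu≉u : F u ≉ u)
    (u-trace : u + F u + F (F u) ≈ 0#) where
    open IntegerSolver L
    open Powers L
    open IntegralDomain.Domain L 1≉0 integral
    open Endomorphisms.RingEndomorphism L F F-cong F-+ F-* F-1
    open import Algebra.Properties.Ring ring using (-‿involutive; -0#≈0#)
    open Conjugates integral F≈0

    F² : Carrier → Carrier
    F² x = F (F x)

    F²-cong : ∀ {x y} → x ≈ y → F² x ≈ F² y
    F²-cong e = F-cong (F-cong e)

    F²-+ : ∀ x y → F² (x + y) ≈ F² x + F² y
    F²-+ x y = trans (F-cong (F-+ x y)) (F-+ _ _)

    F²-* : ∀ x y → F² (x * y) ≈ F² x * F² y
    F²-* x y = trans (F-cong (F-* x y)) (F-* _ _)

    F²-1 : F² 1# ≈ 1#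
    F²-1 = trans (F-cong F-1) F-1

    module F²-hom = Endomorphisms.RingEndomorphism L F² F²-cong F²-+ F²-* F²-1

    v w : Carrier
    v = F u
    w = F² u

    Fw≈u : F w ≈ u
    Fw≈u = trace-zero⇒F³ Fσ u-trace

    F²w≈v : F² w ≈ v
    F²w≈v = F-cong Fw≈u

    u≉v : u ≉ v
    u≉v e = Fu≉u (sym e)

    v≉w : v ≉ w
    v≉w e = u≉v (F-injective e)

    u≉w : u ≉ w
    u≉w e = Fu≉u (trans (F-cong e) Fw≈u)

    quotient-uv : quotient Fσ u v ≈ 0#
    quotient-uv = [ (λ e → contradiction e u≉v) , (λ e → e) ]′ (distinct-roots Fσ u-root (F-root Fσ u-root))

    quotient-uw : quotient Fσ u w ≈ 0#
    quotient-uw = [ (λ e → contradiction e u≉w) , (λ e → e) ]′ (distinct-roots Fσ u-root (F-root Fσ (F-root Fσ u-root)))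

    -- Spelled out so as to agree definitionally with `fromℕ 3`.
    3# : Carrier
    3# = 1# + (1# + (1# + 0#))

    d : Carrier
    d = 3# * (u * u) + - σ

    -- The derivative of the cubic at `u` is the product of the differences to the other roots,
    -- hence nonzero even in characteristic 3.
    d-factors : d ≈ (u + - v) * (u + - w)
    d-factors = modulo₂ u-trace quotient-uv
      (solve 4 (λ u v w s → (one :+ (one :+ (one :+ zer))) :* (u :* u) :- s
        := (u :- v) :* (u :- w) :+ (u :- v) :* (u :+ v :+ w :- zer) :+ one :* (v :* v :+ u :* v :+ (u :* u :- s) :- zer))
        refl u v w σ)

    d≉0 : d ≉ 0#
    d≉0 e = *-nonzero (λ e → u≉v (x-y≈0⇒x≈y e)) (λ e → u≉w (x-y≈0⇒x≈y e)) (trans (sym d-factors) e)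

    ρ : Carrier
    ρ = proj₁ (inverse d d≉0)

    dρ≈1 : d * ρ ≈ 1#
    dρ≈1 = proj₂ (inverse d d≉0)

    T : Carrier → Carrier
    T y = y + F² y + F² (F² y)

    T-cong : ∀ {x y} → x ≈ y → T x ≈ T y
    T-cong e = +-cong (+-cong e (F²-cong e)) (F²-cong (F²-cong e))

    F²-T : ∀ y → F² (T y) ≈ T y
    F²-T y = trans (F²-hom.F-poly (var 0F :+ var 1F :+ var 2F) (refl ∷ refl ∷ F⁶ y ∷ []))
      (solve 3 (λ a b c → b :+ c :+ a := a :+ b :+ c) refl y (F² y) (F² (F² y)))

    F²-σ : F² σ ≈ σ
    F²-σ = trans (F-cong Fσ) Fσ

    -- (u² - σ)ρ, uρ, ρ is the dual basis of 1, u, u² for the trace form of L over F_{q²},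
    -- since f(X)/(X - u) = X² + uX + u² - σ for f = X³ - σX - 1, and f′(u) = d.
    C₀ C₁ C₂ : Carrier → Carrier
    C₀ y = T (y * (ρ * (u * u + - σ)))
    C₁ y = T (y * (ρ * u))
    C₂ y = T (y * ρ)

    expand : ∀ y → y ≈ C₀ y + C₁ y * u + C₂ y * (u * u)
    expand y = sym (trans
      (+-cong (+-cong
        (trace (var 0F :* (var 1F :* (var 2F :* var 2F :- var 3F))))
        (*-congʳ (trace (var 0F :* (var 1F :* var 2F)))))
        (*-congʳ (trace (var 0F :* var 1F))))
      -- The coefficient of `y` collects to `d * ρ`, and those of its two conjugates contain
      -- `f(X) / (X - u)` at `w` and at `v`, which vanish.
      (modulo₃ dρ≈1 quotient-uw quotient-uv
        (solve 10 (λ y r u s y₂ r₂ w y₄ r₄ v →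
          (y :* (r :* (u :* u :- s)) :+ y₂ :* (r₂ :* (w :* w :- s)) :+ y₄ :* (r₄ :* (v :* v :- s)))
            :+ (y :* (r :* u) :+ y₂ :* (r₂ :* w) :+ y₄ :* (r₄ :* v)) :* u
            :+ (y :* r :+ y₂ :* r₂ :+ y₄ :* r₄) :* (u :* u)
          := y :+ y :* (((one :+ (one :+ (one :+ zer))) :* (u :* u) :- s) :* r :- one)
               :+ (y₂ :* r₂) :* (w :* w :+ u :* w :+ (u :* u :- s) :- zer)
               :+ (y₄ :* r₄) :* (v :* v :+ u :* v :+ (u :* u :- s) :- zer))
          refl y ρ u σ (F² y) (F² ρ) w (F² (F² y)) (F² (F² ρ)) v)))
      where
      trace : ∀ (e : Polynomial 4) → T (⟦ e ⟧ (y ∷ ρ ∷ u ∷ σ ∷ []))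
        ≈ ⟦ e ⟧ (y ∷ ρ ∷ u ∷ σ ∷ []) + ⟦ e ⟧ (F² y ∷ F² ρ ∷ w ∷ σ ∷ [])
          + ⟦ e ⟧ (F² (F² y) ∷ F² (F² ρ) ∷ v ∷ σ ∷ [])
      trace e = +-cong (+-congˡ once) (trans (F²-cong once) (F²-hom.F-poly e (refl ∷ refl ∷ F²w≈v ∷ F²-σ ∷ [])))
        where
        once : F² (⟦ e ⟧ (y ∷ ρ ∷ u ∷ σ ∷ [])) ≈ ⟦ e ⟧ (F² y ∷ F² ρ ∷ w ∷ σ ∷ [])
        once = F²-hom.F-poly e (refl ∷ refl ∷ refl ∷ F²-σ ∷ [])

    b : Carrier
    b = σ + - (3# * (u * u))

    -- Since `b + u² = σ - 2u²`, the coefficient of `u²` is divided by -2, and the resulting `γ σ`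
    -- is taken off the constant coefficient.
    α β γ : Carrier → Carrier
    γ y = - (½ * C₂ y)
    β y = C₁ y
    α y = C₀ y + - (γ y * σ)

    expand′ : ∀ y → y ≈ α y + β y * u + γ y * (b + u * u)
    expand′ y = trans (expand y) (modulo ½+½≈1
      (solve 6 (λ c₀ c₁ c₂ h u s → c₀ :+ c₁ :* u :+ c₂ :* (u :* u)
        := c₀ :- (:- (h :* c₂)) :* s :+ c₁ :* u
             :+ (:- (h :* c₂)) :* (s :- (one :+ (one :+ (one :+ zer))) :* (u :* u) :+ u :* u)
             :+ (:- (c₂ :* (u :* u))) :* (h :+ h :- one))
        refl (C₀ y) (C₁ y) (C₂ y) ½ u σ))

    γ-cong : ∀ {x y} → x ≈ y → γ x ≈ γ y
    γ-cong e = -‿cong (*-congˡ (T-cong (*-congʳ e)))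

    β-cong : ∀ {x y} → x ≈ y → β x ≈ β y
    β-cong e = T-cong (*-congʳ e)

    α-cong : ∀ {x y} → x ≈ y → α x ≈ α y
    α-cong e = +-cong (T-cong (*-congʳ e)) (-‿cong (*-congʳ (γ-cong e)))

    F-½ : F ½ ≈ ½
    F-½ = modulo₂ (trans (sym (F-+ ½ ½)) (trans (F-cong ½+½≈1) F-1)) ½+½≈1
      (solve 2 (λ g h → g := h :+ h :* (g :+ g :- one) :+ (:- g) :* (h :+ h :- one)) refl (F ½) ½)

    F²-γ : ∀ y → F² (γ y) ≈ γ y
    F²-γ y = F²-hom.F-poly (:- (var 0F :* var 1F)) (trans (F-cong F-½) F-½ ∷ F²-T _ ∷ [])

    F²-β : ∀ y → F² (β y) ≈ β y
    F²-β y = F²-T _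

    F²-α : ∀ y → F² (α y) ≈ α y
    F²-α y = F²-hom.F-poly (var 0F :- var 1F :* var 2F) (F²-T _ ∷ F²-γ y ∷ F²-σ ∷ [])

    -- Conjugating by `F²` shows that `x + yX + zX²` vanishes at the three distinct points `u`, `w`,
    -- `v`. Divided differences then give zero coefficients from the top down.
    independent : ∀ {x y z} → F² x ≈ x → F² y ≈ y → F² z ≈ z →
      x + y * u + z * (u * u) ≈ 0# → x ≈ 0# × y ≈ 0# × z ≈ 0#
    independent {x} {y} {z} Fx Fy Fz eᵤ = x≈0 , y≈0 , z≈0
      where
      conjugate : ∀ {t t′} → F² t ≈ t′ → x + y * t + z * (t * t) ≈ 0# → x + y * t′ + z * (t′ * t′) ≈ 0#
      conjugate Ft e = trans
        (sym (F²-hom.F-poly (var 0F :+ var 1F :* var 2F :+ var 3F :* (var 2F :* var 2F)) (Fx ∷ Fy ∷ Ft ∷ Fz ∷ [])))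
        (trans (F²-cong e) (trans (F-cong F-0) F-0))

      difference : ∀ {t} → u ≉ t → x + y * t + z * (t * t) ≈ 0# → y + z * (u + t) ≈ 0#
      difference {t} u≉t e = cancelˡ (λ e → u≉t (x-y≈0⇒x≈y e)) (trans (modulo₂ eᵤ e
        (solve 5 (λ x y z u t → (u :- t) :* (y :+ z :* (u :+ t)) := zer
          :+ one :* (x :+ y :* u :+ z :* (u :* u) :- zer) :+ (:- one) :* (x :+ y :* t :+ z :* (t :* t) :- zer)) refl x y z u t))
        (sym (zeroʳ _)))

      e-w : x + y * w + z * (w * w) ≈ 0#
      e-w = conjugate refl eᵤ

      e-v : x + y * v + z * (v * v) ≈ 0#
      e-v = conjugate F²w≈v e-w

      z≈0 : z ≈ 0#
      z≈0 = cancelˡ (λ e → v≉w (x-y≈0⇒x≈y e)) (trans (modulo₂ (difference u≉v e-v) (difference u≉w e-w)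
        (solve 5 (λ y z u v w → (v :- w) :* z := zer :+ one :* (y :+ z :* (u :+ v) :- zer)
          :+ (:- one) :* (y :+ z :* (u :+ w) :- zer)) refl y z u v w)) (sym (zeroʳ _)))

      y≈0 : y ≈ 0#
      y≈0 = modulo₂ (difference u≉v e-v) z≈0
        (solve 4 (λ y z u v → y := zer :+ one :* (y :+ z :* (u :+ v) :- zer) :+ (:- (u :+ v)) :* (z :- zer)) refl y z u v)

      x≈0 : x ≈ 0#
      x≈0 = modulo₃ eᵤ y≈0 z≈0
        (solve 4 (λ x y z u → x := zer :+ one :* (x :+ y :* u :+ z :* (u :* u) :- zer)
          :+ (:- u) :* (y :- zer) :+ (:- (u :* u)) :* (z :- zer)) refl x y z u)

    coordinates-unique : ∀ {x y z x′ y′ z′} →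
      F² x ≈ x → F² y ≈ y → F² z ≈ z → F² x′ ≈ x′ → F² y′ ≈ y′ → F² z′ ≈ z′ →
      x + y * u + z * (b + u * u) ≈ x′ + y′ * u + z′ * (b + u * u) → x ≈ x′ × y ≈ y′ × z ≈ z′
    coordinates-unique {x} {y} {z} {x′} {y′} {z′} Fx Fy Fz Fx′ Fy′ Fz′ e =
      modulo₂ X≈0 z≈z′ (solve 5 (λ x x′ z z′ s → x := x′ :+ one :* ((x :- x′) :+ (z :- z′) :* s :- zer)
        :+ (:- s) :* (z :- z′)) refl x x′ z z′ σ) ,
      x-y≈0⇒x≈y (proj₁ (proj₂ zeros)) ,
      z≈z′
      where
      -- The difference of the two expansions rewritten in powers of `u`, where `z - z′` reappears
      -- with factor -2.
      zeros = independent {x + - x′ + (z + - z′) * σ} {y + - y′} { - (z + - z′ + (z + - z′))}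
        (F²-hom.F-poly (var 0F :- var 1F :+ (var 2F :- var 3F) :* var 4F) (Fx ∷ Fx′ ∷ Fz ∷ Fz′ ∷ F²-σ ∷ []))
        (F²-hom.F-poly (var 0F :- var 1F) (Fy ∷ Fy′ ∷ []))
        (F²-hom.F-poly (:- (var 0F :- var 1F :+ (var 0F :- var 1F))) (Fz ∷ Fz′ ∷ []))
        (modulo e (solve 8 (λ x y z x′ y′ z′ u s →
          let c = s :- (one :+ (one :+ (one :+ zer))) :* (u :* u) :+ u :* u in
          (x :- x′ :+ (z :- z′) :* s) :+ (y :- y′) :* u :+ (:- (z :- z′ :+ (z :- z′))) :* (u :* u)
          := zer :+ one :* ((x :+ y :* u :+ z :* c) :- (x′ :+ y′ :* u :+ z′ :* c)))
          refl x y z x′ y′ z′ u σ))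

      X≈0 = proj₁ zeros

      z≈z′ : z ≈ z′
      z≈z′ = modulo₂ (proj₂ (proj₂ zeros)) ½+½≈1
        (solve 3 (λ z z′ h → z := z′ :+ (:- h) :* (:- (z :- z′ :+ (z :- z′)) :- zer)
          :+ (:- (z :- z′)) :* (h :+ h :- one)) refl z z′ ½)

    -- Conjugation over F_{q³} and Hilbert 90.

    G : Carrier → Carrier
    G x = F (F² x)

    G-cong : ∀ {x y} → x ≈ y → G x ≈ G y
    G-cong e = F-cong (F²-cong e)

    G-1 : G 1# ≈ 1#
    G-1 = trans (F-cong F²-1) F-1

    module G-hom = Endomorphisms.RingEndomorphism L G G-cong (λ x y → trans (F-cong (F²-+ x y)) (F-+ _ _))
      (λ x y → trans (F-cong (F²-* x y)) (F-* _ _)) G-1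

    G-½ : G ½ ≈ ½
    G-½ = trans (F-cong (trans (F-cong F-½) F-½)) F-½

    inverse-fixed : ∀ {x y} → x ≉ 0# → x * y ≈ 1# → G x ≈ x → G y ≈ y
    inverse-fixed {x} {y} x≉0 xy≈1 Gx = cancelˡ x≉0 (trans (sym
      (G-hom.F-poly (var 0F :* var 1F) (Gx ∷ refl ∷ [])))
      (trans (G-cong xy≈1) (trans G-1 (sym xy≈1))))

    anti-inverse : ∀ {x y} → x ≉ 0# → x * y ≈ 1# → G x ≈ - x → G y ≈ - y
    anti-inverse {x} {y} x≉0 xy≈1 Gx = cancelˡ x≉0 (trans (solve 2 (λ x y → x :* y := :- (:- x :* y)) refl x (G y))
      (trans (-‿cong (trans (sym (G-hom.F-poly (var 0F :* var 1F) (Gx ∷ refl ∷ []))) (trans (G-cong xy≈1)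
        (trans G-1 (sym xy≈1)))))
        (solve 2 (λ x y → :- (x :* y) := x :* :- y) refl x y)))

    -- The resolvent `m x` satisfies `m x = c * F (m x)`: applying `c F` shifts its terms
    -- cyclically, and the norm condition closes the cycle. It cannot vanish at all of `1`, `u` and
    -- `u²`.
    hilbert90 : ∀ c → G c ≈ c → c * (F c * F² c) ≈ 1# →
      Σ Carrier λ μ → G μ ≈ μ × μ ≉ 0# × μ ≈ c * F μ
    hilbert90 c Gc norm≈1 = choose (m 1# ≟ 0#) (m u ≟ 0#)
      where
      m : Carrier → Carrier
      m x = x + c * F x + c * F c * F² x

      Fixed : Carrier → Set
      Fixed μ = G μ ≈ μ × μ ≈ c * F μ

      fixed : ∀ {x} → G x ≈ x → Fixed (m x)
      fixed {x} Gx =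
        G-hom.F-poly (var 0F :+ var 1F :* var 2F :+ var 1F :* var 3F :* var 4F)
          (Gx ∷ Gc ∷ F-cong Gx ∷ F-cong Gc ∷ F²-cong Gx ∷ []) ,
        trans (modulo norm≈1
          (solve 6 (λ c c₁ c₂ x x₁ x₂ → x :+ c :* x₁ :+ c :* c₁ :* x₂
            := c :* (x₁ :+ c₁ :* x₂ :+ c₁ :* c₂ :* x) :+ (:- x) :* (c :* (c₁ :* c₂) :- one))
            refl c (F c) (F² c) x (F x) (F² x)))
        (*-congˡ (sym (F-poly (var 0F :+ var 1F :* var 2F :+ var 1F :* var 3F :* var 4F)
          (refl ∷ refl ∷ refl ∷ refl ∷ Gx ∷ []))))

      Gu : G u ≈ u
      Gu = Fw≈u

      Gu² : G (u * u) ≈ u * u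
      Gu² = G-hom.F-poly (var 0F :* var 0F) (Gu ∷ [])

      m1 : m 1# ≈ 1# + c * 1# + c * F c * 1#
      m1 = +-cong (+-congˡ (*-congˡ F-1)) (*-congˡ F²-1)

      mu² : m (u * u) ≈ u * u + c * (v * v) + c * F c * (w * w)
      mu² = +-cong (+-congˡ (*-congˡ (F-* u u))) (*-congˡ (F²-hom.F-poly (var 0F :* var 0F) (refl ∷ [])))

      mu²≉0 : m 1# ≈ 0# → m u ≈ 0# → m (u * u) ≉ 0#
      mu²≉0 e₀ e₁ e₂ = *-nonzero (λ e → u≉v (x-y≈0⇒x≈y e)) (λ e → u≉w (x-y≈0⇒x≈y e))
        -- The weights `v w`, `-(v + w)`, `1` are the coefficients of `(X - v)(X - w)`; they remove
        -- the terms in `v` and `w` and leave this polynomial at `u`.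
        (modulo₃ (trans (sym m1) e₀) e₁ (trans (sym mu²) e₂)
          (solve 5 (λ c c₁ u v w → (u :- v) :* (u :- w) := zer
            :+ (v :* w) :* (one :+ c :* one :+ c :* c₁ :* one :- zer)
            :+ (:- (v :+ w)) :* (u :+ c :* v :+ c :* c₁ :* w :- zer)
            :+ one :* (u :* u :+ c :* (v :* v) :+ c :* c₁ :* (w :* w) :- zer)) refl c (F c) u v w))

      package : ∀ {μ} → Fixed μ → μ ≉ 0# → Σ Carrier λ μ → G μ ≈ μ × μ ≉ 0# × μ ≈ c * F μ
      package (Gμ , e) μ≉0 = _ , Gμ , μ≉0 , e

      choose : Dec (m 1# ≈ 0#) → Dec (m u ≈ 0#) → Σ Carrier λ μ → G μ ≈ μ × μ ≉ 0# × μ ≈ c * F μ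
      choose (no m≉0) _ = package (fixed G-1) m≉0
      choose (yes _) (no m≉0) = package (fixed Gu) m≉0
      choose (yes e₀) (yes e₁) = package (fixed Gu²) (mu²≉0 e₀ e₁)

    F²≉0 : ∀ {x} → x ≉ 0# → F² x ≉ 0#
    F²≉0 x≉0 e = x≉0 (F≈0 (F≈0 e))

    -- The isotopisms onto the target presemifield.

    module Presemifields (q : ℕ) (pow-iterate : ∀ j x → pow x (q ℕ.^ j) ≈ iterate j x) where
      open InField q

      InF-1⇒ : ∀ {x} → InF 1 x → F x ≈ x
      InF-1⇒ {x} e = trans (sym (pow-iterate 1 x)) e

      InF-3⇒ : ∀ {x} → InF 3 x → G x ≈ x
      InF-3⇒ {x} e = trans (sym (pow-iterate 3 x)) e

      ⇒InF-2 : ∀ {x} → F² x ≈ x → InF 2 x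
      ⇒InF-2 {x} e = trans (pow-iterate 2 x) e

      InF-2⇒ : ∀ {x} → InF 2 x → F² x ≈ x
      InF-2⇒ {x} e = trans (sym (pow-iterate 2 x)) e

      ⇒InF-3 : ∀ {x} → G x ≈ x → InF 3 x
      ⇒InF-3 {x} e = trans (pow-iterate 3 x) e

      coordinates : (y : Carrier) → Coords u b y
      coordinates y = α y , β y , γ y , ⇒InF-2 (F²-α y) , ⇒InF-2 (F²-β y) , ⇒InF-2 (F²-γ y) , expand′ y

      coordinatesUnique : ∀ y → CoordsUnique u b y
      coordinatesUnique y _ _ _ _ _ _ Iα Iβ Iγ Iα′ Iβ′ Iγ′ e e′ = coordinates-unique
        (InF-2⇒ Iα) (InF-2⇒ Iβ) (InF-2⇒ Iγ) (InF-2⇒ Iα′) (InF-2⇒ Iβ′) (InF-2⇒ Iγ′) (trans (sym e) e′)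

      good : σ ≉ 0# → GoodUσb u σ b
      good σ≉0 = ⇒InF-3 Fw≈u , (λ Iu → Fu≉u (InF-1⇒ Iu)) , trans (pow-iterate 1 σ) Fσ , σ≉0 ,
        modulo u-root (solve 2 (λ u s → u :* (u :* (u :* one)) := s :* u :+ one
          :+ one :* (u :* (u :* u) :- (s :* u :+ one))) refl u σ) ,
        trans (pow-+ b (q ℕ.^ 3) 1) (trans (*-congʳ (trans (pow-iterate 3 b) Gb))
          (modulo u-root (solve 2 (λ u s → let b = s :- numeral 3 :* (u :* u) in
            b :* (b :* one) := s :* s :+ numeral 9 :* u :+ numeral 3 :* s :* (u :* u)
              :+ (numeral 9 :* u) :* (u :* (u :* u) :- (s :* u :+ one))) refl u σ)))
        where
        numeral : ∀ {n} → ℕ → Polynomial n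
        numeral zero = zer
        numeral (suc n) = one :+ numeral n

        Gb : G b ≈ b
        Gb = G-hom.F-poly (var 1F :- numeral 3 :* (var 0F :* var 0F)) (Fw≈u ∷ trans (F-cong F²-σ) Fσ ∷ [])

      star : Alg
      star = Star u b coordinates

      star-cong : ∀ {x x′ y y′} → x ≈ x′ → y ≈ y′ → Alg._⊙_ star x y ≈ Alg._⊙_ star x′ y′
      star-cong ex ey = +-cong
        (*-cong (+-cong (+-cong (α-cong ey) (*-congʳ (β-cong ey))) (*-congʳ (γ-cong ey))) ex)
        (*-cong (*-congʳ (γ-cong ey)) (pow-cong (q ℕ.^ 3) ex))

      -- `G` negates `δ`, so `1` and `δ` form a basis of `L` over F_{q³}. The two coordinates are
      -- recovered from half the sum and half the difference of an element and its conjugate.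
      linBij : ∀ r ξ a {e δ} → e ≉ 0# → δ ≉ 0# → G δ ≈ - δ → LinBij (DA r ξ a) star
      linBij r ξ a {e} {δ} e≉0 δ≉0 Gδ = record
        { fun = fun
        ; pres = λ _ _ → tt
        ; cong = λ _ _ _ _ (ex , ey) → *-congˡ (+-cong ex (*-congˡ ey))
        ; add = λ (x , y) (x′ , y′) _ _ →
            solve 6 (λ e d x y x′ y′ → e :* ((x :+ x′) :+ d :* (y :+ y′))
              := e :* (x :+ d :* y) :+ e :* (x′ :+ d :* y′)) refl e δ x y x′ y′
        ; inj = injective
        ; surj = surjective
        }
        where
        fun : Carrier × Carrier → Carrier
        fun (x , y) = e * (x + δ * y)

        conjugate : ∀ {x y} → InF 3 x × InF 3 y → G (x + δ * y) ≈ x + - δ * y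
        conjugate (Ix , Iy) = G-hom.F-poly (var 0F :+ var 1F :* var 2F) (InF-3⇒ Ix ∷ Gδ ∷ InF-3⇒ Iy ∷ [])

        injective : ∀ s t → InF 3 (proj₁ s) × InF 3 (proj₂ s) → InF 3 (proj₁ t) × InF 3 (proj₂ t) →
          fun s ≈ fun t → proj₁ s ≈ proj₁ t × proj₂ s ≈ proj₂ t
        injective (x , y) (x′ , y′) I I′ eq =
          modulo₃ plus minus ½+½≈1 (solve 6 (λ x y x′ y′ d h → x := x′
            :+ h :* (x :+ d :* y :- (x′ :+ d :* y′)) :+ h :* (x :+ :- d :* y :- (x′ :+ :- d :* y′))
            :+ (:- (x :- x′)) :* (h :+ h :- one)) refl x y x′ y′ δ ½) ,
          cancelˡ δ≉0 (modulo₃ plus minus ½+½≈1 (solve 6 (λ x y x′ y′ d h → d :* y := d :* y′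
            :+ h :* (x :+ d :* y :- (x′ :+ d :* y′)) :+ (:- h) :* (x :+ :- d :* y :- (x′ :+ :- d :* y′))
            :+ (:- (d :* y :- d :* y′)) :* (h :+ h :- one)) refl x y x′ y′ δ ½))
          where
          plus : x + δ * y ≈ x′ + δ * y′
          plus = cancelˡ e≉0 eq

          minus : x + - δ * y ≈ x′ + - δ * y′
          minus = trans (sym (conjugate I)) (trans (G-cong plus) (conjugate I′))

        surjective : ∀ y → ⊤ → Σ (Carrier × Carrier) λ s → (InF 3 (proj₁ s) × InF 3 (proj₂ s)) × fun s ≈ y
        surjective y _ = (½ * (z + G z) , ½ * (z + - G z) * δ⁻¹) ,
          ( ⇒InF-3 (trans (G-hom.F-poly (var 0F :* (var 1F :+ var 2F)) (G-½ ∷ refl ∷ F⁶ z ∷ []))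
              (*-congˡ (+-comm _ _)))
          , ⇒InF-3 (trans (G-hom.F-poly (var 0F :* (var 1F :- var 2F) :* var 3F) (G-½ ∷ refl ∷ F⁶ z ∷ Gδ⁻¹ ∷ []))
              (solve 4 (λ h z z̄ d → h :* (z̄ :- z) :* (:- d) := h :* (z :- z̄) :* d) refl ½ z (G z) δ⁻¹))) ,
          modulo₃ (proj₂ (inverse e e≉0)) δδ⁻¹≈1 ½+½≈1
            (solve 7 (λ e e⁻¹ d d⁻¹ h z̄ y → let z = e⁻¹ :* y in
              e :* (h :* (z :+ z̄) :+ d :* (h :* (z :- z̄) :* d⁻¹)) := y
                :+ y :* (e :* e⁻¹ :- one)
                :+ (e :* h :* (z :- z̄)) :* (d :* d⁻¹ :- one)
                :+ (e :* z) :* (h :+ h :- one)) refl e e⁻¹ δ δ⁻¹ ½ (G z) y)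
          where
          e⁻¹ = proj₁ (inverse e e≉0)
          δ⁻¹ = proj₁ (inverse δ δ≉0)
          δδ⁻¹≈1 = proj₂ (inverse δ δ≉0)
          z = e⁻¹ * y

          Gδ⁻¹ : G δ⁻¹ ≈ - δ⁻¹
          Gδ⁻¹ = anti-inverse δ≉0 δδ⁻¹≈1 Gδ

      norm-expand : ∀ a → norm a ≈ a * F a * F² a
      norm-expand a = trans (pow-+ a (1 ℕ.+ q) (q ℕ.^ 2))
        (*-cong (*-congˡ (trans (reflexive (≡.cong (pow a) (≡.sym (ℕ.*-identityʳ q)))) (pow-iterate 1 a))) (pow-iterate 2 a))

      Amap-cong : ∀ r a {x y} → x ≈ y → Amap r a x ≈ Amap r a y
      Amap-cong r a e = +-cong (pow-cong (q ℕ.^ r) e) (-‿cong (*-congˡ (pow-cong (q ℕ.^ (3 ℕ.∸ r)) e)))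

      -- The right-hand side is μ A_{-1,r}(x), which is the same for both values of r.
      record Normalizer (r : ℕ) (a : Carrier) : Set where
        field
          ℓ μ : Carrier
          Gℓ : G ℓ ≈ ℓ
          Gμ : G μ ≈ μ
          ℓ≉0 : ℓ ≉ 0#
          μ≉0 : μ ≉ 0#
          normalizes : ∀ x → Amap r a (ℓ * x) ≈ μ * (F x + F² x)

      normalizer : ∀ {r ξ a} → Admissible r ξ a → Normalizer r a
      normalizer {r} {ξ} {a} (r≡ , _ , Ia , _ , norm≈-1) = cases r≡
        where
        c = - a

        Gc : G c ≈ c
        Gc = G-hom.F-poly (:- var 0F) (InF-3⇒ Ia ∷ [])

        norm-c : c * (F c * F² c) ≈ 1#
        norm-c = trans (*-congˡ (*-cong (F-neg a) (F²-hom.F-neg a)))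
          (modulo (trans (sym (norm-expand a)) norm≈-1)
            (solve 3 (λ a a₁ a₂ → :- a :* (:- a₁ :* :- a₂) := one :+ (:- one) :* (a :* a₁ :* a₂ :- (:- one)))
              refl a (F a) (F² a)))

        cases : r ≡ 1 ⊎ r ≡ 2 → Normalizer r a
        -- With `ℓ = F² ν`, the coefficients of `F x` and `F² x` are `ν` and `c * F ν`; they agree
        -- when `ν = c * F ν`.
        cases (inj₁ ≡.refl) = record
          { ℓ = F² ν ; μ = ν ; Gℓ = F²-cong Gν ; Gμ = Gν ; ℓ≉0 = F²≉0 ν≉0 ; μ≉0 = ν≉0
          ; normalizes = λ x → trans
              (+-cong (trans (pow-iterate 1 _) (trans (F-* _ _) (*-congʳ Gν)))
                (-‿cong (*-congˡ (trans (pow-iterate 2 _) (trans (F²-* _ _) (*-congʳ (F-cong Gν)))))))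
              (modulo ν≈cFν (solve 5 (λ n n₁ a x₁ x₂ → n :* x₁ :- a :* (n₁ :* x₂)
                := n :* (x₁ :+ x₂) :+ (:- x₂) :* (n :- (:- a) :* n₁)) refl ν (F ν) a (F x) (F² x)))
          }
          where
          solution = hilbert90 c Gc norm-c
          ν = proj₁ solution
          Gν = proj₁ (proj₂ solution)
          ν≉0 = proj₁ (proj₂ (proj₂ solution))
          ν≈cFν = proj₂ (proj₂ (proj₂ solution))
        -- Now the coefficients are `c * ν` and `F ν`. They agree when `ν = c⁻¹ * F ν`, and `c⁻¹` is
        -- `F c * F² c` because `c` has norm 1.
        cases (inj₂ ≡.refl) = record
          { ℓ = F² ν ; μ = F ν ; Gℓ = F²-cong Gν ; Gμ = F-cong Gν ; ℓ≉0 = F²≉0 ν≉0 ; μ≉0 = λ e → ν≉0 (F≈0 e)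
          ; normalizes = λ x → trans
              (+-cong (trans (pow-iterate 2 _) (trans (F²-* _ _) (*-congʳ (F-cong Gν))))
                (-‿cong (*-congˡ (trans (pow-iterate 1 _) (trans (F-* _ _) (*-congʳ Gν))))))
              (modulo₂ ν≈ norm-c (solve 7 (λ c₁ c₂ n n₁ a x₁ x₂ → n₁ :* x₂ :- a :* (n :* x₁)
                := n₁ :* (x₁ :+ x₂) :+ (:- a :* x₁) :* (n :- c₁ :* c₂ :* n₁)
                  :+ (n₁ :* x₁) :* (:- a :* (c₁ :* c₂) :- one)) refl (F c) (F² c) ν (F ν) a (F x) (F² x)))
          }
          where
          solution = hilbert90 (F c * F² c)
            (G-hom.F-poly (var 0F :* var 1F) (F-cong Gc ∷ F²-cong Gc ∷ []))
            (trans (*-congˡ (*-cong (F-poly (var 0F :* var 1F) (refl ∷ Gc ∷ []))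
                (F²-hom.F-poly (var 0F :* var 1F) (Gc ∷ F-cong Gc ∷ []))))
              (modulo norm-c (solve 3 (λ c c₁ c₂ → c₁ :* c₂ :* (c₂ :* c :* (c :* c₁)) := one
                :+ (c :* (c₁ :* c₂) :+ one) :* (c :* (c₁ :* c₂) :- one)) refl c (F c) (F² c))))
          ν = proj₁ solution
          Gν = proj₁ (proj₂ solution)
          ν≉0 = proj₁ (proj₂ (proj₂ solution))
          ν≈ = proj₂ (proj₂ (proj₂ solution))

      isotopic-star : ∀ r ξ a → Admissible r ξ a → Isotopic (DA r ξ a) star
      isotopic-star r ξ a adm@(_ , (Iξ , nonsquare) , _) =
        linBij r ξ a d≉0 κ≉0 Gκ ,
        linBij r ξ a ℓ≉0 δ≉0 Gδ ,
        linBij r ξ a dℓ⁻¹≉0 κ≉0 Gκ ,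
        λ (s , t) (x , y) (Is , It) (Ix , Iy) → isotopy s t x y (InF-3⇒ Is) (InF-3⇒ It) (InF-3⇒ Ix) (InF-3⇒ Iy)
        where
        open Normalizer (normalizer adm)

        unit≉0 : ∀ {x y} → x * y ≈ 1# → y ≉ 0#
        unit≉0 xy≈1 y≈0 = 1≉0 (trans (sym xy≈1) (trans (*-congˡ y≈0) (zeroʳ _)))

        η = proj₁ (square-root (InF-1⇒ Iξ))
        ηη≈ξ = proj₂ (square-root (InF-1⇒ Iξ))

        -- A square root fixed by `F` would make `ξ` a square in F_q. The odd iterate `G` therefore
        -- negates `η` as well, while `F²` fixes it.
        Fη : F η ≈ - η
        Fη = [ (λ e → contradiction (η , trans (pow-iterate 1 η) e , ηη≈ξ) nonsquare) , (λ e → e) ]′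
          (square-root-conjugate (InF-1⇒ Iξ) ηη≈ξ)

        F²η : F² η ≈ η
        F²η = trans (F-cong Fη) (trans (F-neg η) (trans (-‿cong Fη) (-‿involutive η)))

        Gη : G η ≈ - η
        Gη = trans (F-cong F²η) Fη

        η≉0 : η ≉ 0#
        η≉0 η≈0 = nonsquare (η , trans (pow-iterate 1 η) (trans (F-cong η≈0) (trans F-0 (sym η≈0))) , ηη≈ξ)

        κ = proj₁ (inverse η η≉0)
        ηκ≈1 = proj₂ (inverse η η≉0)

        κ≉0 : κ ≉ 0#
        κ≉0 = unit≉0 ηκ≈1

        Gκ : G κ ≈ - κ
        Gκ = anti-inverse η≉0 ηκ≈1 Gη

        F²κ : F² κ ≈ κ
        F²κ = cancelˡ η≉0 (trans (sym (F²-hom.F-poly (var 0F :* var 1F) (F²η ∷ refl ∷ [])))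
          (trans (F²-cong ηκ≈1) (trans F²-1 (sym ηκ≈1))))

        ℓ⁻¹ = proj₁ (inverse ℓ ℓ≉0)
        ℓℓ⁻¹≈1 = proj₂ (inverse ℓ ℓ≉0)

        ℓ⁻¹≉0 : ℓ⁻¹ ≉ 0#
        ℓ⁻¹≉0 = unit≉0 ℓℓ⁻¹≈1

        Gℓ⁻¹ : G ℓ⁻¹ ≈ ℓ⁻¹
        Gℓ⁻¹ = inverse-fixed ℓ≉0 ℓℓ⁻¹≈1 Gℓ

        dℓ⁻¹≉0 : d * ℓ⁻¹ ≉ 0#
        dℓ⁻¹≉0 = *-nonzero d≉0 ℓ⁻¹≉0

        -- Chosen so that `ℓ (s + δ t) = ℓ s - μ η t`: the scalar `μ` left over by the normalization
        -- is absorbed into the second coordinate.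
        δ = - (μ * ℓ⁻¹ * η)

        δ≉0 : δ ≉ 0#
        δ≉0 e = *-nonzero (*-nonzero μ≉0 ℓ⁻¹≉0) η≉0 (trans (sym (-‿involutive _)) (trans (-‿cong e) -0#≈0#))

        Gδ : G δ ≈ - δ
        Gδ = trans (G-hom.F-poly (:- (var 0F :* var 1F :* var 2F)) (Gμ ∷ Gℓ⁻¹ ∷ Gη ∷ []))
          (solve 3 (λ m l e → :- (m :* l :* (:- e)) := :- (:- (m :* l :* e))) refl μ ℓ⁻¹ η)

        module _ (s t x y : Carrier) (Gs : G s ≈ s) (Gt : G t ≈ t) (Gx : G x ≈ x) (Gy : G y ≈ y) where
          x′ = ℓ⁻¹ * x
          y′ = ℓ⁻¹ * y
          W = ℓ * (s + δ * t)
          Y = d * ℓ⁻¹ * (x + κ * y)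
          τ = x′ + F x′ + F² x′ + κ * (y′ + F y′ + F² y′)

          Amap-normalized : ∀ {z} → Amap r a z ≈ μ * (F (ℓ⁻¹ * z) + F² (ℓ⁻¹ * z))
          Amap-normalized {z} = trans (Amap-cong r a (trans (sym (*-identityˡ z))
            (trans (*-congʳ (sym ℓℓ⁻¹≈1)) (*-assoc ℓ ℓ⁻¹ z)))) (normalizes (ℓ⁻¹ * z))

          GW : pow W (q ℕ.^ 3) ≈ ℓ * (s + - δ * t)
          GW = trans (pow-iterate 3 W)
            (G-hom.F-poly (var 0F :* (var 1F :+ var 2F :* var 3F)) (Gℓ ∷ Gs ∷ Gδ ∷ Gt ∷ []))

          -- `ρ` cancels the factor `d` of `Y`, leaving a plain trace. `F²` fixes `κ`, and on F_{q³}
          -- its square acts as `F`, which accounts for the order of the conjugates.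
          C₂Y : C₂ Y ≈ τ
          C₂Y = trans (T-cong (modulo dρ≈1 (solve 6 (λ d l x k y r → d :* l :* (x :+ k :* y) :* r
              := l :* x :+ k :* (l :* y) :+ (l :* x :+ k :* (l :* y)) :* (d :* r :- one)) refl d ℓ⁻¹ x κ y ρ)))
            (trans (+-cong (+-congˡ once) (trans (F²-cong once) twice))
              (solve 7 (λ x x₂ x₁ y y₂ y₁ k → (x :+ k :* y) :+ (x₂ :+ k :* y₂) :+ (x₁ :+ k :* y₁)
                := x :+ x₁ :+ x₂ :+ k :* (y :+ y₁ :+ y₂)) refl x′ (F² x′) (F x′) y′ (F² y′) (F y′) κ))
            where
            Gx′ : G x′ ≈ x′
            Gx′ = G-hom.F-poly (var 0F :* var 1F) (Gℓ⁻¹ ∷ Gx ∷ [])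

            Gy′ : G y′ ≈ y′
            Gy′ = G-hom.F-poly (var 0F :* var 1F) (Gℓ⁻¹ ∷ Gy ∷ [])

            once : F² (x′ + κ * y′) ≈ F² x′ + κ * F² y′
            once = F²-hom.F-poly (var 0F :+ var 1F :* var 2F) (refl ∷ F²κ ∷ refl ∷ [])

            twice : F² (F² x′ + κ * F² y′) ≈ F x′ + κ * F y′
            twice = F²-hom.F-poly (var 0F :+ var 1F :* var 2F) (F-cong Gx′ ∷ F²κ ∷ F-cong Gy′ ∷ [])

          -- By `expand′` the left side is `Y - γ Y * b`, and `γ Y` is minus half of the trace `τ`.
          leading : α Y + β Y * u + γ Y * (u * u) ≈ Y + ½ * τ * b
          leading = modulo₂ (expand′ Y) C₂Y
            (solve 8 (λ α β c h u b Y τ → α :+ β :* u :+ (:- (h :* c)) :* (u :* u) := (Y :+ h :* τ :* b)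
              :+ (:- one) :* (Y :- (α :+ β :* u :+ (:- (h :* c)) :* (b :+ u :* u)))
              :+ (h :* b) :* (c :- τ)) refl (α Y) (β Y) (C₂ Y) ½ u b Y τ)

          isotopy : d * ((s * x + t * Amap r a y) + κ * (s * y + ξ * (t * Amap r a x)))
            ≈ (α Y + β Y * u + γ Y * (u * u)) * W + γ Y * b * pow W (q ℕ.^ 3)
          isotopy = trans
            (*-congˡ (+-cong (+-congˡ (*-congˡ Amap-normalized)) (*-congˡ (+-congˡ (*-congˡ (*-congˡ Amap-normalized))))))
            (sym (trans (+-cong (*-congʳ leading) (*-cong (*-congʳ (-‿cong (*-congˡ C₂Y))) GW))
              (modulo b≈-d (modulo ℓℓ⁻¹≈1 (modulo₃ ηκ≈1 ηη≈ξ ½+½≈1 identity)))))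
            where
            b≈-d : b ≈ - d
            b≈-d = solve 2 (λ u s → let e = (one :+ (one :+ (one :+ zer))) :* (u :* u) in
              s :- e := :- (e :- s)) refl u σ

            -- Each cofactor serves one relation: `b = -d` brings out the factor `d`, `ℓ ℓ⁻¹ = 1`
            -- undoes the scaling, `η κ = 1` and `η² = ξ` exchange `η` for `κ ξ`, and the last one
            -- halves the doubled trace term.
            identity = solve 17 (λ s t x y μ x₁ x₂ y₁ y₂ κ ξ η l l⁻¹ d b h →
              let δ = :- (μ :* l⁻¹ :* η)
                  Y = d :* l⁻¹ :* (x :+ κ :* y)
                  τ = l⁻¹ :* x :+ x₁ :+ x₂ :+ κ :* (l⁻¹ :* y :+ y₁ :+ y₂)
              in
              (Y :+ h :* τ :* b) :* (l :* (s :+ δ :* t)) :+ (:- (h :* τ)) :* b :* (l :* (s :+ :- δ :* t))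
              := d :* ((s :* x :+ t :* (μ :* (y₁ :+ y₂))) :+ κ :* (s :* y :+ ξ :* (t :* (μ :* (x₁ :+ x₂)))))
                :+ ((h :+ h) :* τ :* l :* δ :* t) :* (b :- (:- d))
                :+ (τ :* d :* μ :* η :* t :+ d :* (x :+ κ :* y) :* (s :+ δ :* t)) :* (l :* l⁻¹ :- one)
                :+ (d :* μ :* t :* (y₁ :+ y₂) :- d :* μ :* t :* η :* (x₁ :+ x₂)) :* (η :* κ :- one)
                :+ (d :* μ :* t :* κ :* (x₁ :+ x₂)) :* (η :* η :- ξ)
                :+ (:- (τ :* d :* l :* δ :* t)) :* (h :+ h :- one))
              refl s t x y μ (F x′) (F² x′) (F y′) (F² y′) κ ξ η ℓ ℓ⁻¹ d b ½

      isotopic-DA : ∀ r ξ a r′ ξ′ a′ → Admissible r ξ a → Admissible r′ ξ′ a′ → Isotopic (DA r ξ a) (DA r′ ξ′ a′)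
      isotopic-DA r ξ a r′ ξ′ a′ adm adm′@(_ , (Iξ′ , _) , Ia′ , _) =
        Isotopism.ThroughCommonIsotope.common-isotope isEquivalence (λ _ → tt) +-cong star-cong
        (λ _ _ (Iu , Iv) (Ix , Iy) →
          ⇒InF-3 (closed-+ (InF-3⇒ Iu) (InF-3⇒ Ix)) , ⇒InF-3 (closed-+ (InF-3⇒ Iv) (InF-3⇒ Iy)))
        (λ _ _ (Iu , Iv) (Ix , Iy) →
          ⇒InF-3 (closed-+ (closed-* (InF-3⇒ Iu) (InF-3⇒ Ix)) (closed-* (InF-3⇒ Iv) (closed-A (InF-3⇒ Iy)))) ,
          ⇒InF-3 (closed-+ (closed-* (InF-3⇒ Iu) (InF-3⇒ Iy))
            (closed-* Gξ′ (closed-* (InF-3⇒ Iv) (closed-A (InF-3⇒ Ix))))))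
        (isotopic-star r ξ a adm) (isotopic-star r′ ξ′ a′ adm′)
        where
        closed-+ : ∀ {x y} → G x ≈ x → G y ≈ y → G (x + y) ≈ x + y
        closed-+ Gx Gy = G-hom.F-poly (var 0F :+ var 1F) (Gx ∷ Gy ∷ [])

        closed-* : ∀ {x y} → G x ≈ x → G y ≈ y → G (x * y) ≈ x * y
        closed-* Gx Gy = G-hom.F-poly (var 0F :* var 1F) (Gx ∷ Gy ∷ [])

        closed-pow : ∀ j {x} → G x ≈ x → G (pow x j) ≈ pow x j
        closed-pow zero Gx = G-1
        closed-pow (suc j) Gx = closed-* Gx (closed-pow j Gx)

        closed-A : ∀ {x} → G x ≈ x → G (Amap r′ a′ x) ≈ Amap r′ a′ x
        closed-A Gx = closed-+ (closed-pow (q ℕ.^ r′) Gx)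
          (G-hom.F-poly (:- (var 0F :* var 1F)) (InF-3⇒ Ia′ ∷ closed-pow (q ℕ.^ (3 ℕ.∸ r′)) Gx ∷ []))

        Gξ′ : G ξ′ ≈ ξ′
        Gξ′ = trans (F²-cong (InF-1⇒ Iξ′)) (trans (F-cong (InF-1⇒ Iξ′)) (InF-1⇒ Iξ′))

-- Odd characteristic and assembly.

odd-prime : ∀ {p} → Prime p → p ≢ 2 → Σ ℕ λ m → p ≡ suc (m ℕ.* 2)
odd-prime {p} pr p≢2 = [ (λ (m , p≡2m) → contradiction (divides m p≡2m) 2∤p) , (λ odd → odd) ]′ (parity p)
  where
  parity : ∀ n → (Σ ℕ λ m → n ≡ m ℕ.* 2) ⊎ (Σ ℕ λ m → n ≡ suc (m ℕ.* 2))
  parity zero = inj₁ (0 , ≡.refl)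
  parity (suc n) = [ (λ (m , e) → inj₂ (m , ≡.cong suc e)) , (λ (m , e) → inj₁ (suc m , ≡.cong suc e)) ]′ (parity n)

  2∤p : ¬ (2 ∣ p)
  2∤p 2∣p = [ (λ ()) , (λ 2≡p → p≢2 (≡.sym 2≡p)) ]′ (prime⇒irreducible pr 2∣p)

module _ {p} (pr : Prime p) (p≢2 : p ≢ 2) (k : ℕ) (L : CommutativeRing 0ℓ 0ℓ)
  (isFiniteField : FieldTheory.IsFiniteFieldOfOrder L ((p ℕ.^ k) ℕ.^ 6)) where
  open CommutativeRing L hiding (zero)
  open FieldTheory L
  open IntegerSolver L
  open Powers L
  open FiniteField L ((p ℕ.^ k) ℕ.^ 6) isFiniteField
  open FieldOfOrderQ⁶ pr k L isFiniteField
  open Frobenius L pr p≈0 k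
  open CubicGenerator pr k L isFiniteField

  -- `p = 1 + 2m` vanishes in `L`; were 2 zero as well, 1 would be zero.
  1+1≉0 : 1# + 1# ≉ 0#
  1+1≉0 2≈0 = 1≉0 (trans (sym (+-identityʳ 1#)) (trans (+-congˡ (sym even≈0))
      (trans (reflexive (≡.cong fromℕ (≡.sym p≡1+2m))) p≈0)))
    where
    m = proj₁ (odd-prime pr p≢2)
    p≡1+2m = proj₂ (odd-prime pr p≢2)

    even≈0 : fromℕ (m ℕ.* 2) ≈ 0#
    even≈0 = trans (fromℕ-* m 2) (trans (*-congˡ (trans (+-congˡ (+-identityʳ 1#)) 2≈0)) (zeroʳ _))

  ½ : Carrier
  ½ = proj₁ (inverse (1# + 1#) 1+1≉0)

  ½+½≈1 : ½ + ½ ≈ 1#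
  ½+½≈1 = trans (solve 1 (λ h → h :+ h := (one :+ one) :* h) refl ½) (proj₂ (inverse (1# + 1#) 1+1≉0))

  open CubicExtension.CubicBasis L 1≉0 integral inverse F F-cong F-+ F-* F-1 (pow≈0 (p ℕ.^ k)) F⁶ _≟_ square-root
    ½ ½+½≈1 σ u Fσ u-root Fu≉u u-trace public using (b; module Presemifields)
  open Presemifields (p ℕ.^ k) pow-iterate public

open import Data.Nat using (_^_)

theorem3p1 : (q : ℕ) → OddPrimePower q →
    (L : CommutativeRing 0ℓ 0ℓ) → FieldTheory.IsFiniteFieldOfOrder L (q ^ 6) →
    let open CommutativeRing L
        open FieldTheory L
        open InField q
    in
    (∀ r ξ a r' ξ' a' → Admissible r ξ a → Admissible r' ξ' a' →
       Isotopic (DA r ξ a) (DA r' ξ' a'))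
    ×
    Σ Carrier (λ u → Σ Carrier λ σ → Σ Carrier λ b →
      GoodUσb u σ b ×
      Σ ((y : Carrier) → Coords u b y) λ co →
        (∀ y → CoordsUnique u b y) ×
        (∀ r ξ a → Admissible r ξ a → Isotopic (DA r ξ a) (Star u b co)))
theorem3p1 _ (p , k , pr , p≢2 , _ , ≡.refl) L isFiniteField =
  isotopic-DA pr p≢2 k L isFiniteField ,
  u , σ , b pr p≢2 k L isFiniteField , good pr p≢2 k L isFiniteField σ≉0 ,
  coordinates pr p≢2 k L isFiniteField , coordinatesUnique pr p≢2 k L isFiniteField ,
  isotopic-star pr p≢2 k L isFiniteField
  where open CubicGenerator pr k L isFiniteField using (u; σ; σ≉0)
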